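{- Let $q$ be a complex number with $|q|<1$, let $m\ge0$ be an integer, and let $x,y$ be complex numbers with $x\ne0$, $x\neq yq$, $(x;q)_m\ne0$ and $(q^2/x;q)_m\neq0$. Then $$\frac{(yq^2/x;q)_m}{(q^2/x;q)_m}\sum_{k=0}^m\begin{bmatrix}m+k\\k\end{bmatrix}_q\frac{(y;q)_k}{(x;q)_k}q^k=1+\frac{q+x}{x-yq}\sum_{k=1}^m\begin{bmatrix}2k-1\\k\end{bmatrix}_q\frac{(y;q)_k(yq/x;q)_k}{(x;q)_k(q^2/x;q)_k}q^k-\frac{yq}{x-yq}\sum_{k=1}^m\begin{bmatrix}2k\\k\end{bmatrix}_q\frac{(y;q)_k(yq/x;q)_k}{(x;q)_k(q^2/x;q)_k}q^{2k}.$$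
   Context: For integers $n\ge 0$, $(x;q)_n=\prod_{i=0}^{n-1}(1-xq^i)$ (empty product equal to $1$). The $q$-binomial coefficient is $\begin{bmatrix}n\\k\end{bmatrix}_q=\frac{(q;q)_n}{(q;q)_{n-k}(q;q)_k}$. -}

module Defs where

open import Algebra.Bundles using (CommutativeRing)
open import Data.Empty using (⊥-elim)
open import Data.Fin.Base using (toℕ)
open import Data.Fin.Properties using (toℕ≤pred[n]; toℕ<n)
open import Data.Nat.Base as ℕ using (ℕ; zero; suc)
import Data.Nat.Properties as ℕ
open import Data.Product.Base using (∃; _×_; _,_; proj₁; proj₂)
open import Data.Sum.Base using (_⊎_; inj₁; inj₂)
open import Level using (0ℓ)
open import Relation.Binary.PropositionalEquality
open import Relation.Nullary using (¬_; yes; no)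

module RationalFacts where

  open import Data.Integer.Base as ℤ using (+_; -[1+_])
  import Data.Integer.Properties as ℤ
  import Data.Rational.Unnormalised.Base as ℚᵘ
  import Data.Rational.Unnormalised.Properties as ℚᵘ
  open import Data.Rational.Base
  open import Data.Rational.Properties
  open import Data.Rational.Solver using (module +-*-Solver)
  open +-*-Solver using (solve; _:+_; _:*_; _:-_; :-_; _:=_; con)

  0<1 : 0ℚ < 1ℚ
  0<1 = positive⁻¹ 1ℚ

  0≤-* : ∀ {p q} → 0ℚ ≤ p → 0ℚ ≤ q → 0ℚ ≤ p * q
  0≤-* {p} {q} 0≤p 0≤q = nonNegative⁻¹ (p * q)
    {{nonNeg*nonNeg⇒nonNeg p {{nonNegative 0≤p}} q {{nonNegative 0≤q}}}}

  0<-* : ∀ {p q} → 0ℚ < p → 0ℚ < q → 0ℚ < p * q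
  0<-* {p} {q} 0<p 0<q = positive⁻¹ (p * q)
    {{pos*pos⇒pos p {{positive 0<p}} q {{positive 0<q}}}}

  0≤-+ : ∀ {p q} → 0ℚ ≤ p → 0ℚ ≤ q → 0ℚ ≤ p + q
  0≤-+ = +-mono-≤

  ≤-by : ∀ {p q d} → 0ℚ ≤ d → q ≡ p + d → p ≤ q
  ≤-by {p} {d = d} 0≤d refl = subst (_≤ p + d) (+-identityʳ p) (+-monoʳ-≤ p 0≤d)

  <-by : ∀ {p q d} → 0ℚ < d → q ≡ p + d → p < q
  <-by {p} {d = d} 0<d refl = subst (_< p + d) (+-identityʳ p) (+-monoʳ-< p 0<d)

  0≤-diff : ∀ {p q} → p ≤ q → 0ℚ ≤ q - p
  0≤-diff {p} {q} p≤q = subst (_≤ q - p) (+-inverseʳ p) (+-monoˡ-≤ (- p) p≤q)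

  0<-diff : ∀ {p q} → p < q → 0ℚ < q - p
  0<-diff {p} {q} p<q = subst (_< q - p) (+-inverseʳ p) (+-monoˡ-< (- p) p<q)

  *-mono : ∀ {r p q} → 0ℚ ≤ r → p ≤ q → r * p ≤ r * q
  *-mono {r} 0≤r = *-monoˡ-≤-nonNeg r {{nonNegative 0≤r}}

  *-mono-<′ : ∀ {r p q} → 0ℚ < r → p < q → r * p < r * q
  *-mono-<′ {r} 0<r = *-monoʳ-<-pos r {{positive 0<r}}

  sq-mono : ∀ {p q} → 0ℚ ≤ p → p ≤ q → p * p ≤ q * q
  sq-mono {p} {q} 0≤p p≤q =
    ≤-by (0≤-* (0≤-diff p≤q) (0≤-+ (≤-trans 0≤p p≤q) 0≤p))
      (solve 2 (λ p q → q :* q := p :* p :+ (q :- p) :* (q :+ p)) refl p q)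

  0≤sq : ∀ p → 0ℚ ≤ p * p
  0≤sq p with ≤-total 0ℚ p
  ... | inj₁ 0≤p = 0≤-* 0≤p 0≤p
  ... | inj₂ p≤0 = subst (0ℚ ≤_)
    (solve 1 (λ p → (:- p) :* (:- p) := p :* p) refl p)
    (0≤-* (neg-antimono-≤ p≤0) (neg-antimono-≤ p≤0))

  half : ℚ → ℚ
  half ε = ½ * ε

  0<half : ∀ {ε} → 0ℚ < ε → 0ℚ < half ε
  0<half = 0<-* (positive⁻¹ ½)

  half+half : ∀ ε → half ε + half ε ≡ ε
  half+half = solve 1 (λ e → con ½ :* e :+ con ½ :* e := e) refl

  half≤ : ∀ {ε} → 0ℚ < ε → half ε ≤ ε
  half≤ {ε} 0<ε = ≤-by (<⇒≤ (0<half 0<ε)) (sym (half+half ε))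

  p≤∣p∣ : ∀ p → p ≤ ∣ p ∣
  p≤∣p∣ p with ≤-total 0ℚ p
  ... | inj₁ 0≤p = ≤-reflexive (sym (0≤p⇒∣p∣≡p 0≤p))
  ... | inj₂ p≤0 = ≤-trans p≤0 (0≤∣p∣ p)

  ∣p-q∣≡∣q-p∣ : ∀ p q → ∣ p - q ∣ ≡ ∣ q - p ∣
  ∣p-q∣≡∣q-p∣ p q = trans (sym (∣-p∣≡∣p∣ (p - q)))
    (cong ∣_∣ (solve 2 (λ p q → :- (p :- q) := q :- p) refl p q))

  p-q<⇒ : ∀ {p q ε} → ∣ p - q ∣ < ε → p < q + ε
  p-q<⇒ {p} {q} {ε} h =
    <-by (0<-diff (≤-<-trans (p≤∣p∣ (p - q)) h))
      (solve 3 (λ p q e → q :+ e := p :+ (e :- (p :- q))) refl p q ε)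

  q-p<⇒ : ∀ {p q ε} → ∣ p - q ∣ < ε → q < p + ε
  q-p<⇒ {p} {q} h = p-q<⇒ (subst (_< _) (∣p-q∣≡∣q-p∣ p q) h)

  ∣p-q∣<-intro : ∀ {p q ε} → p < q + ε → q < p + ε → ∣ p - q ∣ < ε
  ∣p-q∣<-intro {p} {q} {ε} h k with ∣p∣≡p∨∣p∣≡-p (p - q)
  ... | inj₁ e = subst (_< ε) (sym e) (<-by (0<-diff h)
    (solve 3 (λ p q e → e := (p :- q) :+ (q :+ e :- p)) refl p q ε))
  ... | inj₂ e = subst (_< ε) (sym e) (<-by (0<-diff k)
    (solve 3 (λ p q e → e := (:- (p :- q)) :+ (p :+ e :- q)) refl p q ε))

  ≡⇒∣p-q∣< : ∀ {p q ε} → p ≡ q → 0ℚ < ε → ∣ p - q ∣ < ε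
  ≡⇒∣p-q∣< {p} refl 0<ε = subst (_< _) (sym (cong ∣_∣ (+-inverseʳ p))) 0<ε

  +-est : ∀ a b c d {δ η} → ∣ a - c ∣ < δ → ∣ b - d ∣ < η →
          ∣ (a + b) - (c + d) ∣ < δ + η
  +-est a b c d h k = ≤-<-trans
    (subst (λ t → ∣ t ∣ ≤ ∣ a - c ∣ + ∣ b - d ∣)
      (solve 4 (λ a b c d → (a :- c) :+ (b :- d) := (a :+ b) :- (c :+ d)) refl a b c d)
      (∣p+q∣≤∣p∣+∣q∣ (a - c) (b - d)))
    (+-mono-< h k)

  neg-est : ∀ a c {δ} → ∣ a - c ∣ < δ → ∣ (- a) - (- c) ∣ < δ
  neg-est a c h = subst (_< _)
    (trans (∣p-q∣≡∣q-p∣ a c)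
      (cong ∣_∣ (solve 2 (λ a c → c :- a := (:- a) :- (:- c)) refl a c))) h

  *-est : ∀ a b c d {B δ} → 0ℚ < B → ∣ a ∣ ≤ B → ∣ d ∣ ≤ B →
          ∣ a - c ∣ < δ → ∣ b - d ∣ < δ →
          ∣ (a * b) - (c * d) ∣ < B * δ + B * δ
  *-est a b c d {B} {δ} 0<B a≤B d≤B h k = ≤-<-trans
    (subst (λ t → ∣ t ∣ ≤ ∣ a * (b - d) ∣ + ∣ d * (a - c) ∣)
      (solve 4 (λ a b c d → a :* (b :- d) :+ d :* (a :- c) := a :* b :- c :* d) refl a b c d)
      (∣p+q∣≤∣p∣+∣q∣ (a * (b - d)) (d * (a - c))))
    (+-mono-< (one a≤B k) (one d≤B h))
    where
    one : ∀ {u v} → ∣ u ∣ ≤ B → ∣ v ∣ < δ → ∣ u * v ∣ < B * δ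
    one {u} {v} u≤B v<δ = subst (_< _) (sym (∣p*q∣≡∣p∣*∣q∣ u v)) (≤-<-trans
      (*-monoʳ-≤-nonNeg ∣ v ∣ {{nonNegative (0≤∣p∣ v)}} u≤B)
      (*-mono-<′ 0<B v<δ))

  -- With inv 0 = 0 the reciprocal of a sequence can be taken termwise.
  inv : ℚ → ℚ
  inv p with p ≟ 0ℚ
  ... | yes _   = 0ℚ
  ... | no p≢0 = (1/ p) {{≢-nonZero p≢0}}

  *-inv : ∀ {p} → p ≢ 0ℚ → p * inv p ≡ 1ℚ
  *-inv {p} p≢0 with p ≟ 0ℚ
  ... | yes p≡0 = ⊥-elim (p≢0 p≡0)
  ... | no p≢0 = *-inverseʳ p {{≢-nonZero p≢0}}

  0<⇒≢0 : ∀ {p} → 0ℚ < p → p ≢ 0ℚ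
  0<⇒≢0 0<p p≡0 = <⇒≢ 0<p (sym p≡0)

  0<inv : ∀ {p} → 0ℚ < p → 0ℚ < inv p
  0<inv {p} 0<p = *-cancelˡ-<-nonNeg p {{nonNegative (<⇒≤ 0<p)}}
    (subst₂ _<_ (sym (*-zeroʳ p)) (sym (*-inv (0<⇒≢0 0<p))) 0<1)

  scale : ∀ {B ε} → 0ℚ < B → 0ℚ < ε → ∃ λ δ → 0ℚ < δ × B * δ ≡ ε
  scale {B} {ε} 0<B 0<ε = inv B * ε , 0<-* (0<inv 0<B) 0<ε ,
    trans (sym (*-assoc B (inv B) ε))
      (trans (cong (_* ε) (*-inv (0<⇒≢0 0<B))) (*-identityˡ ε))

  inv-est : ∀ {a c ε η} → 0ℚ < ε → ε ≤ a → ε ≤ c → ∣ a - c ∣ < (ε * ε) * η →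
            ∣ inv a - inv c ∣ < η
  inv-est {a} {c} {ε} {η} 0<ε ε≤a ε≤c h =
    *-cancelˡ-<-nonNeg (ε * ε) {{nonNegative (0≤-* (<⇒≤ 0<ε) (<⇒≤ 0<ε))}}
      (≤-<-trans step (subst (_< _) (∣p-q∣≡∣q-p∣ a c) h))
    where
    0<a = <-≤-trans 0<ε ε≤a
    0<c = <-≤-trans 0<ε ε≤c
    0≤ac : 0ℚ ≤ a * c
    0≤ac = 0≤-* (<⇒≤ 0<a) (<⇒≤ 0<c)
    εε≤ac : ε * ε ≤ a * c
    εε≤ac = ≤-trans (*-mono (<⇒≤ 0<ε) ε≤c)
      (*-monoʳ-≤-nonNeg c {{nonNegative (<⇒≤ 0<c)}} ε≤a)
    eq : (a * c) * (inv a - inv c) ≡ c - a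
    eq = trans
      (solve 4 (λ a c u v → (a :* c) :* (u :- v) := c :* (a :* u) :- a :* (c :* v))
        refl a c (inv a) (inv c))
      (cong₂ _-_
        (trans (cong (c *_) (*-inv (0<⇒≢0 0<a))) (*-identityʳ c))
        (trans (cong (a *_) (*-inv (0<⇒≢0 0<c))) (*-identityʳ a)))
    step : (ε * ε) * ∣ inv a - inv c ∣ ≤ ∣ c - a ∣
    step = ≤-trans
      (*-monoʳ-≤-nonNeg ∣ inv a - inv c ∣ {{nonNegative (0≤∣p∣ (inv a - inv c))}} εε≤ac)
      (≤-reflexive (trans
        (cong (_* ∣ inv a - inv c ∣) (sym (0≤p⇒∣p∣≡p 0≤ac)))
        (trans (sym (∣p*q∣≡∣p∣*∣q∣ (a * c) (inv a - inv c))) (cong ∣_∣ eq))))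

  fromℕ : ℕ → ℚ
  fromℕ zero    = 0ℚ
  fromℕ (suc n) = 1ℚ + fromℕ n

  0≤fromℕ : ∀ n → 0ℚ ≤ fromℕ n
  0≤fromℕ zero    = ≤-refl
  0≤fromℕ (suc n) = 0≤-+ (<⇒≤ 0<1) (0≤fromℕ n)

  0<fromℕ : ∀ n → 0ℚ < fromℕ (suc n)
  0<fromℕ n = <-by {d = 1ℚ + fromℕ n} (+-mono-<-≤ 0<1 (0≤fromℕ n)) (sym (+-identityˡ _))

  fromℕ-mono : ∀ {m n} → m ℕ.≤ n → fromℕ m ≤ fromℕ n
  fromℕ-mono {n = n} ℕ.z≤n     = 0≤fromℕ n
  fromℕ-mono (ℕ.s≤s m≤n) = +-monoʳ-≤ 1ℚ (fromℕ-mono m≤n)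

  toℚᵘ-fromℕ : ∀ n → toℚᵘ (fromℕ n) ℚᵘ.≃ ℚᵘ.mkℚᵘ (+ n) 0
  toℚᵘ-fromℕ zero    = ℚᵘ.*≡* refl
  toℚᵘ-fromℕ (suc n) = ℚᵘ.≃-trans (toℚᵘ-homo-+ 1ℚ (fromℕ n))
    (ℚᵘ.≃-trans (ℚᵘ.+-cong (ℚᵘ.≃-refl {toℚᵘ 1ℚ}) (toℚᵘ-fromℕ n))
      (ℚᵘ.*≡* (cong (ℤ._* + 1) (cong (ℤ._+_ (+ 1)) (ℤ.*-identityʳ (+ n))))))

  archimedean : ∀ p → ∃ λ n → p < fromℕ n
  archimedean p@(mkℚ (+ a) d _) = suc a , toℚᵘ-cancel-< (ℚᵘ.<-≤-trans
    (ℚᵘ.*<* (ℤ.<-≤-trans (ℤ.*-monoʳ-<-pos (+ 1) {+ a} {+ suc a} (ℤ.+<+ (ℕ.n<1+n a)))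
       (subst₂ ℤ._≤_ (ℤ.*-comm (+ 1) (+ suc a)) refl
         (subst (ℤ._≤ (+ suc a ℤ.* + suc d)) (ℤ.*-comm (+ suc a) (+ 1))
           (ℤ.*-monoˡ-≤-nonNeg (+ suc a) (ℤ.+≤+ (ℕ.s≤s ℕ.z≤n)))))))
    (ℚᵘ.≤-reflexive (ℚᵘ.≃-sym (toℚᵘ-fromℕ (suc a)))))
  archimedean p@(mkℚ -[1+ a ] d _) = 0 , negative⁻¹ p

  mesh : ℕ → ℚ
  mesh n = inv (fromℕ (suc n))

  0<mesh : ∀ n → 0ℚ < mesh n
  0<mesh n = 0<inv (0<fromℕ n)

  mesh<-scaled : ∀ {ε n} → 1ℚ < ε * fromℕ (suc n) → mesh n < ε
  mesh<-scaled {ε} {n} h = *-cancelˡ-<-nonNeg (fromℕ (suc n))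
    {{nonNegative (0≤fromℕ (suc n))}}
    (subst₂ _<_ (sym (*-inv (0<⇒≢0 (0<fromℕ n)))) (*-comm ε _) h)

  mesh-small : ∀ {ε} → 0ℚ < ε → ∃ λ N → ∀ n → N ℕ.≤ n → mesh n < ε
  mesh-small {ε} 0<ε with archimedean (inv ε)
  ... | N , invε<N = N , λ n N≤n → mesh<-scaled {n = n} (subst (_< ε * fromℕ (suc n)) (*-inv (0<⇒≢0 0<ε))
    (*-mono-<′ 0<ε (<-≤-trans invε<N (fromℕ-mono (ℕ.≤-trans N≤n (ℕ.n≤1+n n))))))

  -- climb h p j is the largest r = i h with i ≤ j and r² ≤ p (for p ≥ 0).
  climb : ℚ → ℚ → ℕ → ℚ
  climb h p zero    = 0ℚ
  climb h p (suc j) with (climb h p j + h) * (climb h p j + h) ≤? p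
  ... | yes _ = climb h p j + h
  ... | no  _ = climb h p j

  climb-lower : ∀ {h p} → 0ℚ < h → 0ℚ ≤ p → ∀ j →
                0ℚ ≤ climb h p j × climb h p j * climb h p j ≤ p
  climb-lower 0<h 0≤p zero = ≤-refl , 0≤p
  climb-lower {h} {p} 0<h 0≤p (suc j) with (climb h p j + h) * (climb h p j + h) ≤? p
  ... | yes le = 0≤-+ (proj₁ (climb-lower 0<h 0≤p j)) (<⇒≤ 0<h) , le
  ... | no  _  = climb-lower 0<h 0≤p j

  climb-upper : ∀ h p j → climb h p j ≡ fromℕ j * h ⊎ p < (climb h p j + h) * (climb h p j + h)
  climb-upper h p zero = inj₁ (sym (*-zeroˡ h))
  climb-upper h p (suc j) with (climb h p j + h) * (climb h p j + h) ≤? p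
  ... | no ≰ = inj₂ (≰⇒> ≰)
  ... | yes le with climb-upper h p j
  ...   | inj₂ gt = ⊥-elim (<-irrefl refl (<-≤-trans gt le))
  ...   | inj₁ eq = inj₁ (trans (cong (_+ h) eq)
    (solve 2 (λ n h → n :* h :+ h := (con 1ℚ :+ n) :* h) refl (fromℕ j) h))

  -- The square root of p, rounded down to a multiple of 1/(n+1).
  rootSteps : ℕ → ℚ → ℕ
  rootSteps n p = proj₁ (archimedean ((1ℚ + p) * fromℕ (suc n)))

  root : ℕ → ℚ → ℚ
  root n p = climb (mesh n) p (rootSteps n p)

  0≤root : ∀ n {p} → 0ℚ ≤ p → 0ℚ ≤ root n p
  0≤root n {p} 0≤p = proj₁ (climb-lower (0<mesh n) 0≤p (rootSteps n p))

  root-lower : ∀ n {p} → 0ℚ ≤ p → root n p * root n p ≤ p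
  root-lower n {p} 0≤p = proj₂ (climb-lower (0<mesh n) 0≤p (rootSteps n p))

  root-upper : ∀ n {p} → 0ℚ ≤ p → p < (root n p + mesh n) * (root n p + mesh n)
  root-upper n {p} 0≤p with climb-upper (mesh n) p (rootSteps n p)
  ... | inj₂ gt = gt
  ... | inj₁ eq = <-≤-trans p<big (sq-mono (0≤-+ (<⇒≤ 0<1) 0≤p) 1+p≤r+h)
    where
    F = fromℕ (suc n)
    steps = rootSteps n p
    1+p<Jh : 1ℚ + p < fromℕ steps * mesh n
    1+p<Jh = *-cancelˡ-<-nonNeg F {{nonNegative (0≤fromℕ (suc n))}}
      (subst₂ _<_ (*-comm (1ℚ + p) F)
        (trans (sym (*-identityʳ (fromℕ steps)))
          (trans (cong (fromℕ steps *_) (sym (*-inv (0<⇒≢0 (0<fromℕ n)))))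
            (solve 3 (λ a b c → a :* (b :* c) := b :* (a :* c)) refl
              (fromℕ steps) F (mesh n))))
        (proj₂ (archimedean ((1ℚ + p) * F))))
    1+p≤r+h : 1ℚ + p ≤ root n p + mesh n
    1+p≤r+h = ≤-trans (<⇒≤ 1+p<Jh) (≤-by (<⇒≤ (0<mesh n)) (cong (_+ mesh n) eq))
    p<big : p < (1ℚ + p) * (1ℚ + p)
    p<big = <-by {d = 1ℚ + (p + p * p)}
      (+-mono-<-≤ 0<1 (0≤-+ 0≤p (0≤sq p)))
      (solve 1 (λ p → (con 1ℚ :+ p) :* (con 1ℚ :+ p) := p :+ (con 1ℚ :+ (p :+ p :* p))) refl p)

  root-close : ∀ {r s h x y η} → 0ℚ ≤ s → 0ℚ < η → 0ℚ ≤ h → h < η →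
               r * r ≤ x → y < (s + h) * (s + h) → x < y + η * η → r < s + (η + η)
  root-close {r} {s} {h} {x} {y} {η} 0≤s 0<η 0≤h h<η rr≤x y<ss x<y+ with r <? s + (η + η)
  ... | yes lt = lt
  ... | no  ≮  = ⊥-elim (<-irrefl refl (<-≤-trans (<-trans x<y+ bound) big))
    where
    big : (s + (η + η)) * (s + (η + η)) ≤ x
    big = ≤-trans (sq-mono (0≤-+ 0≤s (0≤-+ (<⇒≤ 0<η) (<⇒≤ 0<η))) (≮⇒≥ ≮)) rr≤x
    bound : y + η * η < (s + (η + η)) * (s + (η + η))
    bound = <-≤-trans
      (+-monoˡ-< (η * η) (<-≤-trans y<ss (sq-mono (0≤-+ 0≤s 0≤h) (+-monoʳ-≤ s (<⇒≤ h<η)))))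
      (≤-by {d = (η * η + η * η) + (s * η + s * η)}
        (0≤-+ (0≤-+ (0≤sq η) (0≤sq η)) (0≤-+ (0≤-* 0≤s (<⇒≤ 0<η)) (0≤-* 0≤s (<⇒≤ 0<η))))
        (solve 2 (λ s e → (s :+ (e :+ e)) :* (s :+ (e :+ e)) :=
          (s :+ e) :* (s :+ e) :+ e :* e :+ ((e :* e :+ e :* e) :+ (s :* e :+ s :* e)))
          refl s η))

  small-square : ∀ {ε} → 0ℚ < ε → ∃ λ c → 0ℚ < c × c * c ≤ ε
  small-square {ε} 0<ε =
    let 0<B = +-mono-< 0<1 0<ε
        c , 0<c , eq = scale {1ℚ + ε} {ε} 0<B 0<ε
        c≤1 = *-cancelˡ-≤-pos (1ℚ + ε) {{positive 0<B}}
          (≤-by {p = (1ℚ + ε) * c} {q = (1ℚ + ε) * 1ℚ} (<⇒≤ 0<1)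
            (trans (solve 1 (λ e → (con 1ℚ :+ e) :* con 1ℚ := e :+ con 1ℚ) refl ε)
              (cong (_+ 1ℚ) (sym eq))))
        c≤ε = ≤-by {p = c} {q = ε} (0≤-* (<⇒≤ 0<ε) (<⇒≤ 0<c))
          (trans (sym eq) (solve 2 (λ e c → (con 1ℚ :+ e) :* c := c :+ e :* c) refl ε c))
    in c , 0<c , ≤-trans (*-mono (<⇒≤ 0<c) c≤1) (≤-trans (≤-reflexive (*-identityʳ c)) c≤ε)

  root-large : ∀ {c ε r h x} → 0ℚ < c → c * c ≤ ε → 0ℚ ≤ r → 0ℚ ≤ h → h < half c →
               ε ≤ x → x < (r + h) * (r + h) → half c ≤ r
  root-large {c} {r = r} {h = h} 0<c cc≤ε 0≤r 0≤h h< ε≤x x< = ≮⇒≥ λ r< →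
    <-irrefl refl (<-≤-trans x< (≤-trans
      (sq-mono (0≤-+ 0≤r 0≤h)
        (≤-trans (<⇒≤ (+-mono-< r< h<)) (≤-reflexive (half+half c))))
      (≤-trans cc≤ε ε≤x)))

  below-one : ∀ {t r h x} → 0ℚ < t → 0ℚ ≤ r → 0ℚ ≤ h → h ≤ t → r + (t + t) ≤ 1ℚ →
              x < (r + h) * (r + h) → x + t ≤ 1ℚ
  below-one {t} {r} {h} {x} 0<t 0≤r 0≤h h≤t r+2t≤1 x< =
    ≤-trans (+-monoˡ-≤ t (≤-trans (<⇒≤ x<) (*-mono (0≤-+ 0≤r 0≤h) r+h≤1)))
      (≤-by (0≤-+ (0≤-diff r+2t≤1) (0≤-diff h≤t))
        (solve 3 (λ t r h → con 1ℚ := ((r :+ h) :* con 1ℚ :+ t) :+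
          ((con 1ℚ :- (r :+ (t :+ t))) :+ (t :- h))) refl t r h))
    where
    r+h≤1 : r + h ≤ 1ℚ
    r+h≤1 = ≤-trans (+-monoʳ-≤ r h≤t)
      (≤-trans (+-monoʳ-≤ r (≤-by (<⇒≤ 0<t) refl)) r+2t≤1)

  submult : ∀ {a b ε η} → 0ℚ ≤ a → 0ℚ < η → a + ε ≤ 1ℚ → b + η ≤ 1ℚ → a * b + ε ≤ 1ℚ
  submult {a} {b} {ε} {η} 0≤a 0<η p q =
    ≤-by (0≤-+ (0≤-diff p) (0≤-* 0≤a (0≤-+ (0≤-diff q) (<⇒≤ 0<η))))
      (solve 4 (λ a b e n → con 1ℚ := (a :* b :+ e) :+
        ((con 1ℚ :- (a :+ e)) :+ a :* ((con 1ℚ :- (b :+ n)) :+ n))) refl a b ε η)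

  away-from-one : ∀ {a b ε} → 0ℚ < ε → (a * a + b * b) + ε ≤ 1ℚ →
                  half ε * half ε ≤ (1ℚ - a) * (1ℚ - a) + b * b
  away-from-one {a} {b} {ε} 0<ε p = ≤-trans
    (sq-mono (<⇒≤ (0<half 0<ε)) half≤1-a)
    (≤-by (0≤sq b) refl)
    where
    half≤1-a : half ε ≤ 1ℚ - a
    half≤1-a = ≤-by
      (0≤-* (<⇒≤ (positive⁻¹ ½)) (0≤-+ (0≤-+ (0≤sq (1ℚ - a)) (0≤sq b)) (0≤-diff p)))
      (solve 3 (λ a b e → con 1ℚ :- a := con ½ :* e :+ con ½ :*
        ((((con 1ℚ :- a) :* (con 1ℚ :- a)) :+ b :* b) :+ (con 1ℚ :- ((a :* a :+ b :* b) :+ e))))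
        refl a b ε)

  factor-large : ∀ {a b ε B} → 0ℚ ≤ a → 0ℚ < B → ∣ b ∣ ≤ B → ε ≤ a * b → inv B * ε ≤ a
  factor-large {a} {b} {ε} {B} 0≤a 0<B b≤B ε≤ab = ≤-trans
    (*-mono (<⇒≤ (0<inv 0<B)) (≤-trans ε≤ab (*-mono 0≤a (≤-trans (p≤∣p∣ b) b≤B))))
    (≤-reflexive (trans
      (solve 3 (λ i a b → i :* (a :* b) := (b :* i) :* a) refl (inv B) a B)
      (trans (cong (_* a) (*-inv (0<⇒≢0 0<B))) (*-identityˡ a))))

  sq<⇒∣∣< : ∀ {p ε} → 0ℚ < ε → p * p < ε * ε → ∣ p ∣ < ε
  sq<⇒∣∣< {p} {ε} 0<ε lt = ≰⇒> λ ε≤∣p∣ → <-irrefl refl (<-≤-trans lt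
    (≤-trans (sq-mono (<⇒≤ 0<ε) ε≤∣p∣) (≤-reflexive
      (trans (sym (∣p*q∣≡∣p∣*∣q∣ p p)) (0≤p⇒∣p∣≡p (0≤sq p))))))

module Reals where

  open import Data.Rational.Base
  open import Data.Rational.Properties
  open import Data.Rational.Solver using (module +-*-Solver)
  open +-*-Solver using (solve; _:+_; _:*_; _:-_; :-_; _:=_; con)
  open RationalFacts

  Eventually : (ℕ → Set) → Set
  Eventually P = ∃ λ N → ∀ n → N ℕ.≤ n → P n

  Eventually₂ : (ℕ → ℕ → Set) → Set
  Eventually₂ P = ∃ λ N → ∀ m n → N ℕ.≤ m → N ℕ.≤ n → P m n

  ev-map : ∀ {P Q : ℕ → Set} → (∀ n → P n → Q n) → Eventually P → Eventually Q
  ev-map f (N , p) = N , λ n N≤n → f n (p n N≤n)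

  ev-all : ∀ {P : ℕ → Set} → (∀ n → P n) → Eventually P
  ev-all p = 0 , λ n _ → p n

  ev-× : ∀ {P Q : ℕ → Set} → Eventually P → Eventually Q → Eventually (λ n → P n × Q n)
  ev-× (M , p) (N , q) = M ℕ.⊔ N , λ n le →
    p n (ℕ.≤-trans (ℕ.m≤m⊔n M N) le) , q n (ℕ.≤-trans (ℕ.m≤n⊔m M N) le)

  ev₂-map : ∀ {P Q : ℕ → ℕ → Set} → (∀ m n → P m n → Q m n) → Eventually₂ P → Eventually₂ Q
  ev₂-map f (N , p) = N , λ m n N≤m N≤n → f m n (p m n N≤m N≤n)

  ev₂-× : ∀ {P Q : ℕ → ℕ → Set} → Eventually₂ P → Eventually₂ Q →
          Eventually₂ (λ m n → P m n × Q m n)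
  ev₂-× (M , p) (N , q) = M ℕ.⊔ N , λ m n le le′ →
    p m n (ℕ.≤-trans (ℕ.m≤m⊔n M N) le) (ℕ.≤-trans (ℕ.m≤m⊔n M N) le′) ,
    q m n (ℕ.≤-trans (ℕ.m≤n⊔m M N) le) (ℕ.≤-trans (ℕ.m≤n⊔m M N) le′)

  both : ∀ {P : ℕ → Set} → Eventually P → Eventually₂ (λ m n → P m × P n)
  both (N , p) = N , λ m n N≤m N≤n → p m N≤m , p n N≤n

  Cauchy : (ℕ → ℚ) → Set
  Cauchy s = ∀ ε → 0ℚ < ε → Eventually₂ λ m n → ∣ s m - s n ∣ < ε

  -- Reals are Cauchy sequences of rationals; real equality is the relation _≃ᵣ_,
  -- so ℝ is used as a setoid.
  record ℝ : Set where
    no-eta-equality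
    constructor mkℝ
    field
      seq    : ℕ → ℚ
      cauchy : Cauchy seq

  open ℝ public

  infix 4 _≃ᵣ_ _<ᵣ_

  record _≃ᵣ_ (x y : ℝ) : Set where
    constructor mk≃
    field
      close : ∀ ε → 0ℚ < ε → Eventually λ n → ∣ seq x n - seq y n ∣ < ε

  open _≃ᵣ_ public

  _<ᵣ_ : ℝ → ℝ → Set
  x <ᵣ y = ∃ λ ε → 0ℚ < ε × Eventually λ n → seq x n + ε ≤ seq y n

  ≗⇒≃ : ∀ {x y} → (∀ n → seq x n ≡ seq y n) → x ≃ᵣ y
  ≗⇒≃ h = mk≃ λ ε 0<ε → ev-all λ n → ≡⇒∣p-q∣< (h n) 0<ε

  ≃ᵣ-refl : ∀ {x} → x ≃ᵣ x
  ≃ᵣ-refl = ≗⇒≃ λ _ → refl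

  ≃ᵣ-sym : ∀ {x y} → x ≃ᵣ y → y ≃ᵣ x
  ≃ᵣ-sym {x} {y} h = mk≃ λ ε 0<ε → ev-map
    (λ n → subst (_< ε) (∣p-q∣≡∣q-p∣ (seq x n) (seq y n))) (close h ε 0<ε)

  ≃ᵣ-trans : ∀ {x y z} → x ≃ᵣ y → y ≃ᵣ z → x ≃ᵣ z
  ≃ᵣ-trans {x} {y} {z} h k = mk≃ λ ε 0<ε → ev-map
    (λ n (p , q) → subst₂ _<_
      (cong ∣_∣ (solve 3 (λ a b c → (a :+ b) :- (b :+ c) := a :- c) refl
        (seq x n) (seq y n) (seq z n)))
      (half+half ε)
      (+-est (seq x n) (seq y n) (seq y n) (seq z n) p q))
    (ev-× (close h (half ε) (0<half 0<ε)) (close k (half ε) (0<half 0<ε)))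

  bounded : ∀ {s} → Cauchy s → ∃ λ B → 0ℚ < B × Eventually λ n → ∣ s n ∣ ≤ B
  bounded {s} c with c 1ℚ 0<1
  ... | N , h = 1ℚ + ∣ s N ∣ , +-mono-<-≤ 0<1 (0≤∣p∣ (s N)) , N , λ n N≤n →
    ≤-trans
      (subst (λ t → ∣ t ∣ ≤ ∣ s n - s N ∣ + ∣ s N ∣)
        (solve 2 (λ a b → (a :- b) :+ b := a) refl (s n) (s N))
        (∣p+q∣≤∣p∣+∣q∣ (s n - s N) (s N)))
      (+-monoˡ-≤ ∣ s N ∣ (<⇒≤ (h n N N≤n ℕ.≤-refl)))

  const-cauchy : ∀ p → Cauchy (λ _ → p)
  const-cauchy p ε 0<ε = 0 , λ _ _ _ _ → ≡⇒∣p-q∣< {p} refl 0<ε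

  +-cauchy : ∀ {s t} → Cauchy s → Cauchy t → Cauchy (λ n → s n + t n)
  +-cauchy {s} {t} c d ε 0<ε = ev₂-map
    (λ m n (p , q) → subst (∣ (s m + t m) - (s n + t n) ∣ <_) (half+half ε)
      (+-est (s m) (t m) (s n) (t n) p q))
    (ev₂-× (c (half ε) (0<half 0<ε)) (d (half ε) (0<half 0<ε)))

  neg-cauchy : ∀ {s} → Cauchy s → Cauchy (λ n → - s n)
  neg-cauchy {s} c ε 0<ε = ev₂-map (λ m n → neg-est (s m) (s n)) (c ε 0<ε)

  *-tol : ∀ {B C ε} → 0ℚ < B → 0ℚ < C → 0ℚ < ε → ∃ λ δ → 0ℚ < δ ×
          (∀ a b c d → ∣ a ∣ ≤ B → ∣ d ∣ ≤ C →
            ∣ a - c ∣ < δ → ∣ b - d ∣ < δ → ∣ a * b - c * d ∣ < ε)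
  *-tol {B} {C} {ε} 0<B 0<C 0<ε with scale (+-mono-< 0<B 0<C) (0<half 0<ε)
  ... | δ , 0<δ , eq = δ , 0<δ , λ a b c d a≤B d≤C p q →
    subst (∣ a * b - c * d ∣ <_) (trans (cong₂ _+_ eq eq) (half+half ε))
      (*-est a b c d (+-mono-< 0<B 0<C)
        (≤-trans a≤B (≤-by (<⇒≤ 0<C) refl))
        (≤-trans d≤C (≤-by (<⇒≤ 0<B) (+-comm B C))) p q)

  *-cauchy : ∀ {s t} → Cauchy s → Cauchy t → Cauchy (λ n → s n * t n)
  *-cauchy {s} {t} c d ε 0<ε =
    let B , 0<B , hB = bounded {s} c
        C , 0<C , hC = bounded {t} d
        δ , 0<δ , est = *-tol 0<B 0<C 0<ε
    in ev₂-map
      (λ m n (((u , _) , (_ , v)) , (p , q)) → est (s m) (t m) (s n) (t n) u v p q)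
      (ev₂-× (ev₂-× (both hB) (both hC)) (ev₂-× (c δ 0<δ) (d δ 0<δ)))

  infixl 6 _+ᵣ_
  infixl 7 _*ᵣ_
  infix  8 -ᵣ_

  0ᵣ 1ᵣ : ℝ
  0ᵣ = mkℝ (λ _ → 0ℚ) (const-cauchy 0ℚ)
  1ᵣ = mkℝ (λ _ → 1ℚ) (const-cauchy 1ℚ)

  _+ᵣ_ _*ᵣ_ : ℝ → ℝ → ℝ
  seq    (x +ᵣ y) n = seq x n + seq y n
  cauchy (x +ᵣ y)   = +-cauchy {seq x} {seq y} (cauchy x) (cauchy y)
  seq    (x *ᵣ y) n = seq x n * seq y n
  cauchy (x *ᵣ y)   = *-cauchy {seq x} {seq y} (cauchy x) (cauchy y)

  -ᵣ_ : ℝ → ℝ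
  seq    (-ᵣ x) n = - seq x n
  cauchy (-ᵣ x)   = neg-cauchy {seq x} (cauchy x)

  +ᵣ-cong : ∀ {x x′ y y′} → x ≃ᵣ x′ → y ≃ᵣ y′ → x +ᵣ y ≃ᵣ x′ +ᵣ y′
  +ᵣ-cong {x} {x′} {y} {y′} h k = mk≃ λ ε 0<ε → ev-map
    (λ n (p , q) → subst (∣ (seq x n + seq y n) - (seq x′ n + seq y′ n) ∣ <_) (half+half ε)
      (+-est (seq x n) (seq y n) (seq x′ n) (seq y′ n) p q))
    (ev-× (close h (half ε) (0<half 0<ε)) (close k (half ε) (0<half 0<ε)))

  -ᵣ-cong : ∀ {x x′} → x ≃ᵣ x′ → -ᵣ x ≃ᵣ -ᵣ x′
  -ᵣ-cong {x} {x′} h = mk≃ λ ε 0<ε → ev-map (λ n → neg-est (seq x n) (seq x′ n)) (close h ε 0<ε)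

  *ᵣ-cong : ∀ {x x′ y y′} → x ≃ᵣ x′ → y ≃ᵣ y′ → x *ᵣ y ≃ᵣ x′ *ᵣ y′
  *ᵣ-cong {x} {x′} {y} {y′} h k = mk≃ λ ε 0<ε →
    let B , 0<B , hB = bounded {seq x} (cauchy x)
        C , 0<C , hC = bounded {seq y′} (cauchy y′)
        δ , 0<δ , est = *-tol 0<B 0<C 0<ε
    in ev-map
      (λ n ((u , v) , (p , q)) → est (seq x n) (seq y n) (seq x′ n) (seq y′ n) u v p q)
      (ev-× (ev-× hB hC) (ev-× (close h δ 0<δ) (close k δ 0<δ)))

  0<ᵣ⇒eventually : ∀ {x} → 0ᵣ <ᵣ x → ∃ λ ε → 0ℚ < ε × Eventually λ n → ε ≤ seq x n
  0<ᵣ⇒eventually (ε , 0<ε , h) =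
    ε , 0<ε , ev-map (λ n → ≤-trans (≤-reflexive (sym (+-identityˡ ε)))) h

  eventually⇒0<ᵣ : ∀ {x} → (∃ λ ε → 0ℚ < ε × Eventually λ n → ε ≤ seq x n) → 0ᵣ <ᵣ x
  eventually⇒0<ᵣ (ε , 0<ε , h) =
    ε , 0<ε , ev-map (λ n → ≤-trans (≤-reflexive (+-identityˡ ε))) h

  <ᵣ-resp-≃ : ∀ {x x′ y y′} → x ≃ᵣ x′ → y ≃ᵣ y′ → x <ᵣ y → x′ <ᵣ y′
  <ᵣ-resp-≃ {x} {x′} {y} {y′} h k (ε , 0<ε , l) = η , 0<η , ev-map
    (λ n (p , q , r) → ≤-by
      (0≤-+ (0≤-+ (0≤-diff (<⇒≤ (q-p<⇒ {seq x n} p))) (0≤-diff (<⇒≤ (p-q<⇒ {seq y n} q))))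
        (0≤-+ (0≤-diff r) (<⇒≤ 0<η)))
      (solve 5 (λ a a′ b b′ e →
          let η = con ½ :* (con ½ :* e) in
          b′ := a′ :+ η :+
            ((a :+ η :- a′) :+ (b′ :+ η :- b) :+ ((b :- (a :+ e)) :+ η)))
        refl (seq x n) (seq x′ n) (seq y n) (seq y′ n) ε))
    (ev-× (close h η 0<η) (ev-× (close k η 0<η) l))
    where
    η = half (half ε)
    0<η = 0<half (0<half 0<ε)

  recip-cauchy : ∀ x → 0ᵣ <ᵣ x → Cauchy (λ n → inv (seq x n))
  recip-cauchy x p η 0<η =
    let ε , 0<ε , h = 0<ᵣ⇒eventually {x} p
    in ev₂-map (λ m n ((u , v) , w) → inv-est 0<ε u v w)
      (ev₂-× (both h) (cauchy x _ (0<-* (0<-* 0<ε 0<ε) 0<η)))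

  recip : (x : ℝ) → 0ᵣ <ᵣ x → ℝ
  seq    (recip x 0<x) n = inv (seq x n)
  cauchy (recip x 0<x)   = recip-cauchy x 0<x

  *-recip : ∀ x (0<x : 0ᵣ <ᵣ x) → x *ᵣ recip x 0<x ≃ᵣ 1ᵣ
  *-recip x 0<x =
    let ε , 0<ε , h = 0<ᵣ⇒eventually {x} 0<x
    in mk≃ λ η 0<η → ev-map
      (λ n u → ≡⇒∣p-q∣< (*-inv (0<⇒≢0 (<-≤-trans 0<ε u))) 0<η) h

  module _ (x : ℝ) (0≤x : ∀ n → 0ℚ ≤ seq x n) where

    private
      rt : ℕ → ℚ
      rt n = root n (seq x n)

      rt-close : ∀ {η} m n → 0ℚ < η → mesh n < η →
                 seq x m < seq x n + η * η → rt m < rt n + (η + η)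
      rt-close m n 0<η h<η lt = root-close {x = seq x m} {y = seq x n}
        (0≤root n (0≤x n)) 0<η (<⇒≤ (0<mesh n)) h<η
        (root-lower m (0≤x m)) (root-upper n (0≤x n)) lt

    abstract
      √-cauchy : Cauchy rt
      √-cauchy ε 0<ε =
        let 0<η = 0<half 0<ε
            fine = mesh-small 0<η
        in ev₂-map
          (λ m n ((hm , hn) , c) → subst (∣ rt m - rt n ∣ <_) (half+half ε)
            (∣p-q∣<-intro
              (rt-close m n 0<η hn (p-q<⇒ {seq x m} c))
              (rt-close n m 0<η hm (q-p<⇒ {seq x m} c))))
          (ev₂-× (both fine) (cauchy x (half ε * half ε) (0<-* 0<η 0<η)))

    -- The nonnegative square root of x; see √*√.
    √ : ℝ
    seq    √ = rt
    cauchy √ = √-cauchy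

    √*√ : √ *ᵣ √ ≃ᵣ x
    √*√ = mk≃ λ ε 0<ε →
      let B , 0<B , hB = bounded {rt} √-cauchy
          δ , 0<δ , eq = scale {B + B + 1ℚ} {ε} (+-mono-< (+-mono-< 0<B 0<B) 0<1) 0<ε
      in ev-map
        (λ n (b , h<δ , h<1) → ∣p-q∣<-intro
          (≤-<-trans (root-lower n (0≤x n)) (<-by 0<ε refl))
          (<-≤-trans (root-upper n (0≤x n)) (≤-by
            (0≤-+ (0≤-* (<⇒≤ (0<mesh n))
                    (0≤-+ (0≤-+ (0≤-diff (≤-trans (p≤∣p∣ (rt n)) b))
                                (0≤-diff (≤-trans (p≤∣p∣ (rt n)) b)))
                          (0≤-diff (<⇒≤ h<1))))
                  (0≤-* (0≤-+ (0≤-+ (<⇒≤ 0<B) (<⇒≤ 0<B)) (<⇒≤ 0<1)) (0≤-diff (<⇒≤ h<δ))))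
            (trans (cong (rt n * rt n +_) (sym eq))
              (solve 4 (λ r h b d →
                  r :* r :+ (b :+ b :+ con 1ℚ) :* d :=
                  (r :+ h) :* (r :+ h) :+
                    (h :* ((b :- r) :+ (b :- r) :+ (con 1ℚ :- h)) :+
                     (b :+ b :+ con 1ℚ) :* (d :- h)))
                refl (rt n) (mesh n) B δ)))))
        (ev-× hB (ev-× (mesh-small 0<δ) (mesh-small 0<1)))

    0<√⇒0< : 0ᵣ <ᵣ √ → 0ᵣ <ᵣ x
    0<√⇒0< p =
      let ε , 0<ε , h = 0<ᵣ⇒eventually {√} p
      in eventually⇒0<ᵣ {x} (ε * ε , 0<-* 0<ε 0<ε , ev-map
        (λ n ε≤r → ≤-trans (sq-mono (<⇒≤ 0<ε) ε≤r) (root-lower n (0≤x n))) h)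

    0<⇒0<√ : 0ᵣ <ᵣ x → 0ᵣ <ᵣ √
    0<⇒0<√ p =
      let ε , 0<ε , h = 0<ᵣ⇒eventually {x} p
          c , 0<c , cc≤ε = small-square 0<ε
      in eventually⇒0<ᵣ {√} (half c , 0<half 0<c , ev-map
        (λ n (ε≤x , h<) → root-large 0<c cc≤ε (0≤root n (0≤x n)) (<⇒≤ (0<mesh n)) h<
          ε≤x (root-upper n (0≤x n)))
        (ev-× h (mesh-small (0<half 0<c))))

    √<1⇒<1 : √ <ᵣ 1ᵣ → x <ᵣ 1ᵣ
    √<1⇒<1 (ε , 0<ε , h) = half ε , 0<half 0<ε , ev-map
      (λ n (r+ε≤1 , h<) → below-one (0<half 0<ε) (0≤root n (0≤x n)) (<⇒≤ (0<mesh n)) (<⇒≤ h<)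
        (≤-trans (≤-reflexive (cong (rt n +_) (half+half ε))) r+ε≤1)
        (root-upper n (0≤x n)))
      (ev-× h (mesh-small (0<half 0<ε)))

module ComplexNumbers where

  open import Algebra.Structures using (IsCommutativeRing)
  open import Data.Rational.Base
  open import Data.Rational.Properties
  open import Data.Rational.Solver using (module +-*-Solver)
  open import Relation.Binary.Structures using (IsEquivalence)
  open +-*-Solver using (solve; _:+_; _:*_; _:-_; :-_; _:=_; con)
  open RationalFacts
  open Reals

  record ℂ : Set where
    no-eta-equality
    constructor _+i_
    field
      re im : ℝ

  open ℂ public

  infix 4 _≈ᶜ_

  record _≈ᶜ_ (z w : ℂ) : Set where
    constructor mk≈
    field
      re≃ : re z ≃ᵣ re w
      im≃ : im z ≃ᵣ im w

  open _≈ᶜ_ public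

  infixl 6 _+ᶜ_ _-ᶜ_
  infixl 7 _*ᶜ_
  infix  8 -ᶜ_

  0ᶜ 1ᶜ : ℂ
  0ᶜ = 0ᵣ +i 0ᵣ
  1ᶜ = 1ᵣ +i 0ᵣ

  _+ᶜ_ _*ᶜ_ : ℂ → ℂ → ℂ
  re (z +ᶜ w) = re z +ᵣ re w
  im (z +ᶜ w) = im z +ᵣ im w
  re (z *ᶜ w) = re z *ᵣ re w +ᵣ -ᵣ (im z *ᵣ im w)
  im (z *ᶜ w) = re z *ᵣ im w +ᵣ im z *ᵣ re w

  -ᶜ_ : ℂ → ℂ
  re (-ᶜ z) = -ᵣ re z
  im (-ᶜ z) = -ᵣ im z

  _-ᶜ_ : ℂ → ℂ → ℂ
  z -ᶜ w = z +ᶜ (-ᶜ w)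

  abstract
    ≈-isEquivalence : IsEquivalence _≈ᶜ_
    ≈-isEquivalence = record
      { refl  = mk≈ ≃ᵣ-refl ≃ᵣ-refl
      ; sym   = λ p → mk≈ (≃ᵣ-sym (re≃ p)) (≃ᵣ-sym (im≃ p))
      ; trans = λ p q → mk≈ (≃ᵣ-trans (re≃ p) (re≃ q)) (≃ᵣ-trans (im≃ p) (im≃ q))
      }

    +ᶜ-cong : ∀ {z z′ w w′} → z ≈ᶜ z′ → w ≈ᶜ w′ → z +ᶜ w ≈ᶜ z′ +ᶜ w′
    +ᶜ-cong {z} {z′} {w} {w′} p q = mk≈
      (+ᵣ-cong {re z} {re z′} {re w} {re w′} (re≃ p) (re≃ q))
      (+ᵣ-cong {im z} {im z′} {im w} {im w′} (im≃ p) (im≃ q))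

    *ᶜ-cong : ∀ {z z′ w w′} → z ≈ᶜ z′ → w ≈ᶜ w′ → z *ᶜ w ≈ᶜ z′ *ᶜ w′
    *ᶜ-cong {z} {z′} {w} {w′} p q = mk≈
      (+ᵣ-cong {re z *ᵣ re w} {re z′ *ᵣ re w′} { -ᵣ (im z *ᵣ im w)} { -ᵣ (im z′ *ᵣ im w′)}
        (*ᵣ-cong {re z} {re z′} {re w} {re w′} (re≃ p) (re≃ q))
        (-ᵣ-cong {im z *ᵣ im w} {im z′ *ᵣ im w′}
          (*ᵣ-cong {im z} {im z′} {im w} {im w′} (im≃ p) (im≃ q))))
      (+ᵣ-cong {re z *ᵣ im w} {re z′ *ᵣ im w′} {im z *ᵣ re w} {im z′ *ᵣ re w′}
        (*ᵣ-cong {re z} {re z′} {im w} {im w′} (re≃ p) (im≃ q))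
        (*ᵣ-cong {im z} {im z′} {re w} {re w′} (im≃ p) (re≃ q)))

    -ᶜ-cong : ∀ {z z′} → z ≈ᶜ z′ → -ᶜ z ≈ᶜ -ᶜ z′
    -ᶜ-cong {z} {z′} p = mk≈
      (-ᵣ-cong {re z} {re z′} (re≃ p)) (-ᵣ-cong {im z} {im z′} (im≃ p))

    +ᶜ-assoc : ∀ u v w → (u +ᶜ v) +ᶜ w ≈ᶜ u +ᶜ (v +ᶜ w)
    +ᶜ-assoc u v w = mk≈
      (≗⇒≃ λ n → +-assoc (seq (re u) n) (seq (re v) n) (seq (re w) n))
      (≗⇒≃ λ n → +-assoc (seq (im u) n) (seq (im v) n) (seq (im w) n))

    +ᶜ-comm : ∀ u v → u +ᶜ v ≈ᶜ v +ᶜ u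
    +ᶜ-comm u v = mk≈
      (≗⇒≃ λ n → +-comm (seq (re u) n) (seq (re v) n))
      (≗⇒≃ λ n → +-comm (seq (im u) n) (seq (im v) n))

    +ᶜ-identityˡ : ∀ u → 0ᶜ +ᶜ u ≈ᶜ u
    +ᶜ-identityˡ u = mk≈
      (≗⇒≃ λ n → +-identityˡ (seq (re u) n)) (≗⇒≃ λ n → +-identityˡ (seq (im u) n))

    +ᶜ-identityʳ : ∀ u → u +ᶜ 0ᶜ ≈ᶜ u
    +ᶜ-identityʳ u = mk≈
      (≗⇒≃ λ n → +-identityʳ (seq (re u) n)) (≗⇒≃ λ n → +-identityʳ (seq (im u) n))

    -ᶜ-inverseˡ : ∀ u → (-ᶜ u) +ᶜ u ≈ᶜ 0ᶜ
    -ᶜ-inverseˡ u = mk≈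
      (≗⇒≃ λ n → +-inverseˡ (seq (re u) n)) (≗⇒≃ λ n → +-inverseˡ (seq (im u) n))

    -ᶜ-inverseʳ : ∀ u → u +ᶜ (-ᶜ u) ≈ᶜ 0ᶜ
    -ᶜ-inverseʳ u = mk≈
      (≗⇒≃ λ n → +-inverseʳ (seq (re u) n)) (≗⇒≃ λ n → +-inverseʳ (seq (im u) n))

    *ᶜ-comm : ∀ u v → u *ᶜ v ≈ᶜ v *ᶜ u
    *ᶜ-comm u v = mk≈
      (≗⇒≃ λ n → solve 4 (λ a b c d → a :* c :+ :- (b :* d) := c :* a :+ :- (d :* b)) refl
        (seq (re u) n) (seq (im u) n) (seq (re v) n) (seq (im v) n))
      (≗⇒≃ λ n → solve 4 (λ a b c d → a :* d :+ b :* c := c :* b :+ d :* a) refl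
        (seq (re u) n) (seq (im u) n) (seq (re v) n) (seq (im v) n))

    *ᶜ-assoc : ∀ u v w → (u *ᶜ v) *ᶜ w ≈ᶜ u *ᶜ (v *ᶜ w)
    *ᶜ-assoc u v w = mk≈
      (≗⇒≃ λ n → solve 6 (λ a b c d e f →
          (a :* c :+ :- (b :* d)) :* e :+ :- ((a :* d :+ b :* c) :* f) :=
          a :* (c :* e :+ :- (d :* f)) :+ :- (b :* (c :* f :+ d :* e))) refl
        (seq (re u) n) (seq (im u) n) (seq (re v) n) (seq (im v) n)
        (seq (re w) n) (seq (im w) n))
      (≗⇒≃ λ n → solve 6 (λ a b c d e f →
          (a :* c :+ :- (b :* d)) :* f :+ (a :* d :+ b :* c) :* e :=
          a :* (c :* f :+ d :* e) :+ b :* (c :* e :+ :- (d :* f))) refl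
        (seq (re u) n) (seq (im u) n) (seq (re v) n) (seq (im v) n)
        (seq (re w) n) (seq (im w) n))

    *ᶜ-identityˡ : ∀ u → 1ᶜ *ᶜ u ≈ᶜ u
    *ᶜ-identityˡ u = mk≈
      (≗⇒≃ λ n → solve 2 (λ a b → con 1ℚ :* a :+ :- (con 0ℚ :* b) := a) refl
        (seq (re u) n) (seq (im u) n))
      (≗⇒≃ λ n → solve 2 (λ a b → con 1ℚ :* b :+ con 0ℚ :* a := b) refl
        (seq (re u) n) (seq (im u) n))

    *ᶜ-identityʳ : ∀ u → u *ᶜ 1ᶜ ≈ᶜ u
    *ᶜ-identityʳ u = IsEquivalence.trans ≈-isEquivalence (*ᶜ-comm u 1ᶜ) (*ᶜ-identityˡ u)

    *ᶜ-distribˡ : ∀ u v w → u *ᶜ (v +ᶜ w) ≈ᶜ u *ᶜ v +ᶜ u *ᶜ w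
    *ᶜ-distribˡ u v w = mk≈
      (≗⇒≃ λ n → solve 6 (λ a b c d e f →
          a :* (c :+ e) :+ :- (b :* (d :+ f)) :=
          (a :* c :+ :- (b :* d)) :+ (a :* e :+ :- (b :* f))) refl
        (seq (re u) n) (seq (im u) n) (seq (re v) n) (seq (im v) n)
        (seq (re w) n) (seq (im w) n))
      (≗⇒≃ λ n → solve 6 (λ a b c d e f →
          a :* (d :+ f) :+ b :* (c :+ e) :=
          (a :* d :+ b :* c) :+ (a :* f :+ b :* e)) refl
        (seq (re u) n) (seq (im u) n) (seq (re v) n) (seq (im v) n)
        (seq (re w) n) (seq (im w) n))

    *ᶜ-distribʳ : ∀ u v w → (v +ᶜ w) *ᶜ u ≈ᶜ v *ᶜ u +ᶜ w *ᶜ u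
    *ᶜ-distribʳ u v w = IsEquivalence.trans ≈-isEquivalence (*ᶜ-comm (v +ᶜ w) u)
      (IsEquivalence.trans ≈-isEquivalence (*ᶜ-distribˡ u v w)
        (+ᶜ-cong (*ᶜ-comm u v) (*ᶜ-comm u w)))

  ℂ-isCommutativeRing : IsCommutativeRing _≈ᶜ_ _+ᶜ_ _*ᶜ_ -ᶜ_ 0ᶜ 1ᶜ
  ℂ-isCommutativeRing = record
    { isRing = record
      { +-isAbelianGroup = record
        { isGroup = record
          { isMonoid = record
            { isSemigroup = record
              { isMagma = record
                { isEquivalence = ≈-isEquivalence
                ; ∙-cong        = +ᶜ-cong
                }
              ; assoc = +ᶜ-assoc
              }
            ; identity = +ᶜ-identityˡ , +ᶜ-identityʳ
            }
          ; inverse = -ᶜ-inverseˡ , -ᶜ-inverseʳ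
          ; ⁻¹-cong = -ᶜ-cong
          }
        ; comm = +ᶜ-comm
        }
      ; *-cong     = *ᶜ-cong
      ; *-assoc    = *ᶜ-assoc
      ; *-identity = *ᶜ-identityˡ , *ᶜ-identityʳ
      ; distrib    = *ᶜ-distribˡ , *ᶜ-distribʳ
      }
    ; *-comm = *ᶜ-comm
    }

  ℂ-commutativeRing : CommutativeRing 0ℓ 0ℓ
  ℂ-commutativeRing = record { isCommutativeRing = ℂ-isCommutativeRing }

  normSq : ℂ → ℝ
  normSq z = re z *ᵣ re z +ᵣ im z *ᵣ im z

  0≤normSq : ∀ z n → 0ℚ ≤ seq (normSq z) n
  0≤normSq z n = 0≤-+ (0≤sq (seq (re z) n)) (0≤sq (seq (im z) n))

  ∣_∣ᶜ : ℂ → ℝ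
  ∣ z ∣ᶜ = √ (normSq z) (0≤normSq z)

  infix 4 _#_

  -- Apartness, the constructive form of z ≠ w: the distance is positive.  Its
  -- negation is equality (≈⇒¬#, ¬#⇒≈), so classically z # w is z ≠ w.
  record _#_ (z w : ℂ) : Set where
    constructor apart
    field
      0<distance : 0ᵣ <ᵣ ∣ z -ᶜ w ∣ᶜ

  open _#_ public

  normSq-cong : ∀ {z w} → z ≈ᶜ w → normSq z ≃ᵣ normSq w
  normSq-cong {z} {w} p = +ᵣ-cong
    {re z *ᵣ re z} {re w *ᵣ re w} {im z *ᵣ im z} {im w *ᵣ im w}
    (*ᵣ-cong {re z} {re w} {re z} {re w} (re≃ p) (re≃ p))
    (*ᵣ-cong {im z} {im w} {im z} {im w} (im≃ p) (im≃ p))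

  NonNull : ℂ → Set
  NonNull z = 0ᵣ <ᵣ normSq z

  NonNull-cong : ∀ {z w} → z ≈ᶜ w → NonNull z → NonNull w
  NonNull-cong {z} {w} p = <ᵣ-resp-≃ {0ᵣ} {0ᵣ} {normSq z} {normSq w} ≃ᵣ-refl (normSq-cong p)

  #⇒NonNull : ∀ {z w} → z # w → NonNull (z -ᶜ w)
  #⇒NonNull {z} {w} p = 0<√⇒0< (normSq (z -ᶜ w)) (0≤normSq (z -ᶜ w)) (0<distance p)

  NonNull⇒# : ∀ {z w} → NonNull (z -ᶜ w) → z # w
  NonNull⇒# {z} {w} p = apart (0<⇒0<√ (normSq (z -ᶜ w)) (0≤normSq (z -ᶜ w)) p)

  abstract
    -ᶜ0 : ∀ z → z -ᶜ 0ᶜ ≈ᶜ z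
    -ᶜ0 z = mk≈
      (≗⇒≃ λ n → solve 1 (λ a → a :+ :- con 0ℚ := a) refl (seq (re z) n))
      (≗⇒≃ λ n → solve 1 (λ a → a :+ :- con 0ℚ := a) refl (seq (im z) n))

    #0⇒NonNull : ∀ {z} → z # 0ᶜ → NonNull z
    #0⇒NonNull {z} p = NonNull-cong {z -ᶜ 0ᶜ} {z} (-ᶜ0 z) (#⇒NonNull {z} {0ᶜ} p)

    NonNull⇒#0 : ∀ {z} → NonNull z → z # 0ᶜ
    NonNull⇒#0 {z} p = NonNull⇒# {z} {0ᶜ}
      (NonNull-cong {z} {z -ᶜ 0ᶜ} (IsEquivalence.sym ≈-isEquivalence (-ᶜ0 z)) p)

    #⇒-#0 : ∀ {z w} → z # w → z -ᶜ w # 0ᶜ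
    #⇒-#0 {z} {w} p = NonNull⇒#0 {z -ᶜ w} (#⇒NonNull {z} {w} p)

    #-cong : ∀ {z z′ w w′} → z ≈ᶜ z′ → w ≈ᶜ w′ → z # w → z′ # w′
    #-cong {z} {z′} {w} {w′} p q r = NonNull⇒# {z′} {w′}
      (NonNull-cong {z -ᶜ w} {z′ -ᶜ w′} (+ᶜ-cong p (-ᶜ-cong q)) (#⇒NonNull {z} {w} r))

    normSq-* : ∀ z w → normSq (z *ᶜ w) ≃ᵣ normSq z *ᵣ normSq w
    normSq-* z w = ≗⇒≃ λ n → solve 4 (λ a b c d →
        (a :* c :+ :- (b :* d)) :* (a :* c :+ :- (b :* d)) :+
        (a :* d :+ b :* c) :* (a :* d :+ b :* c) :=
        (a :* a :+ b :* b) :* (c :* c :+ d :* d)) refl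
      (seq (re z) n) (seq (im z) n) (seq (re w) n) (seq (im w) n)

    #0-* : ∀ {z w} → z # 0ᶜ → w # 0ᶜ → z *ᶜ w # 0ᶜ
    #0-* {z} {w} p q =
      let ε , 0<ε , h = 0<ᵣ⇒eventually {normSq z} (#0⇒NonNull {z} p)
          η , 0<η , k = 0<ᵣ⇒eventually {normSq w} (#0⇒NonNull {w} q)
      in NonNull⇒#0 {z *ᶜ w} (<ᵣ-resp-≃ {0ᵣ} {0ᵣ} {normSq z *ᵣ normSq w} {normSq (z *ᶜ w)}
        ≃ᵣ-refl (≃ᵣ-sym (normSq-* z w))
        (eventually⇒0<ᵣ {normSq z *ᵣ normSq w} (ε * η , 0<-* 0<ε 0<η , ev-map
          (λ n (u , v) → ≤-trans (*-mono (<⇒≤ 0<ε) v)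
            (*-monoʳ-≤-nonNeg (seq (normSq w) n) {{nonNegative (0≤normSq w n)}} u))
          (ev-× h k))))

    #0-*ˡ : ∀ {z w} → z *ᶜ w # 0ᶜ → z # 0ᶜ
    #0-*ˡ {z} {w} p =
      let ε , 0<ε , h = 0<ᵣ⇒eventually {normSq z *ᵣ normSq w}
            (<ᵣ-resp-≃ {0ᵣ} {0ᵣ} {normSq (z *ᶜ w)} {normSq z *ᵣ normSq w}
              ≃ᵣ-refl (normSq-* z w) (#0⇒NonNull {z *ᶜ w} p))
          B , 0<B , hB = bounded {seq (normSq w)} (cauchy (normSq w))
      in NonNull⇒#0 {z} (eventually⇒0<ᵣ {normSq z} (inv B * ε , 0<-* (0<inv 0<B) 0<ε , ev-map
        (λ n (u , v) → factor-large (0≤normSq z n) 0<B v u) (ev-× h hB)))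

    1#0 : 1ᶜ # 0ᶜ
    1#0 = NonNull⇒#0 {1ᶜ} (eventually⇒0<ᵣ {normSq 1ᶜ} (1ℚ , 0<1 , ev-all λ _ → ≤-refl))

  InDisc : ℂ → Set
  InDisc z = normSq z <ᵣ 1ᵣ

  abstract
    ∣∣<1⇒InDisc : ∀ {z} → ∣ z ∣ᶜ <ᵣ 1ᵣ → InDisc z
    ∣∣<1⇒InDisc {z} = √<1⇒<1 (normSq z) (0≤normSq z)

    InDisc-cong : ∀ {z w} → z ≈ᶜ w → InDisc z → InDisc w
    InDisc-cong {z} {w} p =
      <ᵣ-resp-≃ {normSq z} {normSq w} {1ᵣ} {1ᵣ} (normSq-cong p) ≃ᵣ-refl

    InDisc-* : ∀ {z w} → InDisc z → InDisc w → InDisc (z *ᶜ w)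
    InDisc-* {z} {w} (ε , 0<ε , h) (η , 0<η , k) =
      <ᵣ-resp-≃ {normSq z *ᵣ normSq w} {normSq (z *ᶜ w)} {1ᵣ} {1ᵣ}
        (≃ᵣ-sym (normSq-* z w)) ≃ᵣ-refl
        (ε , 0<ε , ev-map (λ n (u , v) → submult (0≤normSq z n) 0<η u v) (ev-× h k))

    InDisc⇒1-#0 : ∀ {z} → InDisc z → 1ᶜ -ᶜ z # 0ᶜ
    InDisc⇒1-#0 {z} (ε , 0<ε , h) = NonNull⇒#0 {1ᶜ -ᶜ z}
      (<ᵣ-resp-≃ {0ᵣ} {0ᵣ} {N} {normSq (1ᶜ -ᶜ z)} ≃ᵣ-refl
        (≗⇒≃ λ n → solve 2 (λ a b →
            (con 1ℚ :+ :- a) :* (con 1ℚ :+ :- a) :+ b :* b :=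
            (con 1ℚ :+ :- a) :* (con 1ℚ :+ :- a) :+
            (con 0ℚ :+ :- b) :* (con 0ℚ :+ :- b)) refl
          (seq (re z) n) (seq (im z) n))
        (eventually⇒0<ᵣ {N} (half ε * half ε , 0<-* (0<half 0<ε) (0<half 0<ε) ,
          ev-map (λ n → away-from-one {seq (re z) n} {seq (im z) n} 0<ε) h)))
      where
      N : ℝ
      N = (1ᵣ +ᵣ -ᵣ re z) *ᵣ (1ᵣ +ᵣ -ᵣ re z) +ᵣ im z *ᵣ im z

  infix 9 _⁻¹[_]

  _⁻¹[_] : (z : ℂ) → z # 0ᶜ → ℂ
  re (z ⁻¹[ z#0 ]) = re z *ᵣ recip (normSq z) (#0⇒NonNull {z} z#0)
  im (z ⁻¹[ z#0 ]) = -ᵣ (im z *ᵣ recip (normSq z) (#0⇒NonNull {z} z#0))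

  abstract
    *-⁻¹ : ∀ z (z#0 : z # 0ᶜ) → z *ᶜ z ⁻¹[ z#0 ] ≈ᶜ 1ᶜ
    *-⁻¹ z z#0 = mk≈
      (≃ᵣ-trans
        (≗⇒≃ {re (z *ᶜ z ⁻¹[ z#0 ])} {normSq z *ᵣ r} λ n → solve 3 (λ a b r →
            a :* (a :* r) :+ :- (b :* (:- (b :* r))) := (a :* a :+ b :* b) :* r) refl
          (seq (re z) n) (seq (im z) n) (seq r n))
        (*-recip (normSq z) (#0⇒NonNull {z} z#0)))
      (≗⇒≃ λ n → solve 3 (λ a b r →
          a :* (:- (b :* r)) :+ b :* (a :* r) := con 0ℚ) refl
        (seq (re z) n) (seq (im z) n) (seq r n))
      where
      r : ℝ
      r = recip (normSq z) (#0⇒NonNull {z} z#0)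

    ≈⇒¬# : ∀ {z w} → z ≈ᶜ w → ¬ (z # w)
    ≈⇒¬# {z} {w} p z#w =
      let ε , 0<ε , N , h = 0<ᵣ⇒eventually {normSq 0ᶜ} (NonNull-cong {z -ᶜ w} {0ᶜ}
            (IsEquivalence.trans ≈-isEquivalence
              (+ᶜ-cong p (IsEquivalence.refl ≈-isEquivalence)) (-ᶜ-inverseʳ w))
            (#⇒NonNull {z} {w} z#w))
      in <-irrefl refl (<-≤-trans 0<ε (h N ℕ.≤-refl))

    ¬#⇒≈ : ∀ {z w} → ¬ (z # w) → z ≈ᶜ w
    ¬#⇒≈ {z} {w} ¬z#w = mk≈ (part {re z} {re w} re-small) (part {im z} {im w} im-small)
      where
      d : ℂ
      d = z -ᶜ w
      small : ∀ ε → 0ℚ < ε → Eventually λ n → seq (normSq d) n < ε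
      small ε 0<ε = go (cauchy (normSq d) (half ε) (0<half 0<ε))
        where
        go : Eventually₂ (λ m n → ∣ seq (normSq d) m - seq (normSq d) n ∣ < half ε) →
             Eventually λ n → seq (normSq d) n < ε
        go (N , h) = N , λ n N≤n → ≰⇒> λ ε≤n → ¬z#w (NonNull⇒# {z} {w}
          (eventually⇒0<ᵣ {normSq d} (half ε , 0<half 0<ε , N , λ m N≤m → ≮⇒≥ λ m< →
            <-irrefl refl (<-≤-trans
              (<-≤-trans (q-p<⇒ {seq (normSq d) m} (h m n N≤m N≤n))
                (≤-trans (<⇒≤ (+-monoˡ-< (half ε) m<)) (≤-reflexive (half+half ε))))
              ε≤n))))
      part : ∀ {x y} → (∀ n → (seq x n - seq y n) * (seq x n - seq y n) ≤ seq (normSq d) n) →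
             x ≃ᵣ y
      part {x} {y} le = mk≃ λ ε 0<ε → ev-map
        (λ n lt → sq<⇒∣∣< 0<ε (≤-<-trans (le n) lt)) (small (ε * ε) (0<-* 0<ε 0<ε))
      re-small : ∀ n → (seq (re z) n - seq (re w) n) * (seq (re z) n - seq (re w) n) ≤
                 seq (normSq d) n
      re-small n = ≤-by (0≤sq (seq (im z) n - seq (im w) n)) refl
      im-small : ∀ n → (seq (im z) n - seq (im w) n) * (seq (im z) n - seq (im w) n) ≤
                 seq (normSq d) n
      im-small n = ≤-by (0≤sq (seq (re z) n - seq (re w) n)) (+-comm
        ((seq (re z) n - seq (re w) n) * (seq (re z) n - seq (re w) n))
        ((seq (im z) n - seq (im w) n) * (seq (im z) n - seq (im w) n)))

open Reals public using (ℝ; 1ᵣ; _<ᵣ_)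
open ComplexNumbers public
  using (ℂ; _#_; _⁻¹[_]; *-⁻¹; #⇒-#0; #0-*; #0-*ˡ; ℂ-commutativeRing)
  renaming (∣_∣ᶜ to ∣_∣)
open ComplexNumbers using (InDisc; InDisc-*; InDisc-cong; InDisc⇒1-#0; ∣∣<1⇒InDisc; 1#0)

open CommutativeRing ℂ-commutativeRing public
  using (_≈_; _+_; _*_; -_; _-_)
  renaming (0# to 0ℂ; 1# to 1ℂ)

open import Algebra.Properties.Semiring.Exp (CommutativeRing.semiring ℂ-commutativeRing) public
  using (_^_)
open import Algebra.Properties.Semiring.Sum (CommutativeRing.semiring ℂ-commutativeRing) public
  using (sum)

infixl 7 _/_[_]

-- Division is by a number known to be apart from 0; the quotient does not depend,
-- up to _≈_, on which proof of apartness is supplied.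
_/_[_] : ℂ → (w : ℂ) → w # 0ℂ → ℂ
z / w [ w#0 ] = z * w ⁻¹[ w#0 ]

-- poch x q n is (x; q)ₙ.
poch : ℂ → ℂ → ℕ → ℂ
poch x q zero    = 1ℂ
poch x q (suc n) = poch x q n * (1ℂ - x * q ^ n)

abstract
  poch-≤ : ∀ {x q k m} → k ℕ.≤ m → poch x q m # 0ℂ → poch x q k # 0ℂ
  poch-≤ {x} {q} {k} k≤m = go (ℕ.≤⇒≤′ k≤m)
    where
    go : ∀ {m} → k ℕ.≤′ m → poch x q m # 0ℂ → poch x q k # 0ℂ
    go ℕ.≤′-refl                p = p
    go (ℕ.≤′-step {n = m} k≤′m) p = go k≤′m (#0-*ˡ p)

  poch-q-q : ∀ {q} → ∣ q ∣ <ᵣ 1ᵣ → ∀ n → poch q q n # 0ℂ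
  poch-q-q {q} ∣q∣<1 = go
    where
    module C = CommutativeRing ℂ-commutativeRing

    power : ∀ n → InDisc (q * q ^ n)
    power zero    = InDisc-cong {q} {q * 1ℂ} (C.sym (C.*-identityʳ q)) (∣∣<1⇒InDisc {q} ∣q∣<1)
    power (suc n) = InDisc-* {q} {q * q ^ n} (∣∣<1⇒InDisc {q} ∣q∣<1) (power n)

    go : ∀ n → poch q q n # 0ℂ
    go zero    = 1#0
    go (suc n) = #0-* (go n) (InDisc⇒1-#0 {q * q ^ n} (power n))

-- Meaningful for k ≤ n only, since ∸ truncates.
qbinom : (q : ℂ) → ∣ q ∣ <ᵣ 1ᵣ → ℕ → ℕ → ℂ
qbinom q ∣q∣<1 n k =
  poch q q n / (poch q q (n ℕ.∸ k) * poch q q k)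
    [ #0-* (poch-q-q ∣q∣<1 (n ℕ.∸ k)) (poch-q-q ∣q∣<1 k) ]

-- The sums of f k over 0 ≤ k ≤ m and over 1 ≤ k ≤ m.  The summand receives the
-- bound k ≤ m, which is what makes its denominators invertible.
sum₀ sum₁ : (m : ℕ) → ((k : ℕ) → k ℕ.≤ m → ℂ) → ℂ
sum₀ m f = sum {suc m} λ i → f (toℕ i) (toℕ≤pred[n] i)
sum₁ m f = sum {m} λ i → f (suc (toℕ i)) (toℕ<n i)

{-# OPTIONS --safe #-}
module Submission where

-- With n = m + 1, the summands F of the left-hand side for m and n satisfy
-- F n k - F m k = G m (k+1) - G m k with G m 0 = 0, so passing from m to n adds
-- F n n + G m n, which is the n-th term of the right-hand side.

open import Algebra.Bundles using (CommutativeRing)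

-- A ring solver whose coefficients are integers, where equality is decidable.

module IntegerCoefficients {c ℓ} (R : CommutativeRing c ℓ) where

  open import Data.Integer.Base as ℤ using (ℤ; +_; -[1+_]; _⊖_; _◃_)
  import Data.Integer.Properties as ℤ
  open import Data.Nat.Base as ℕ using (ℕ; zero; suc)
  import Data.Nat.Properties as ℕ
  open import Data.Sign.Base as Sign using (Sign)
  open import Data.Maybe.Base as Maybe using (Maybe)
  open import Relation.Nullary.Decidable.Core using (dec⇒maybe)
  import Relation.Binary.PropositionalEquality as ≡
  open import Algebra.Solver.Ring.AlmostCommutativeRing
    using (fromCommutativeRing; _-Raw-AlmostCommutative⟶_)
  open CommutativeRing R
  open import Algebra.Properties.Ring ring
    using (-‿distribˡ-*; -‿distribʳ-*; -0#≈0#; -‿involutive; -‿+-comm)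
  open import Algebra.Properties.Semiring.Mult.TCOptimised semiring
  open import Relation.Binary.Reasoning.Setoid setoid

  -- In this form of multiplication `1 × 1#` is `1#` by definition, with no summand `0#`, so the
  -- literals `con (ℤ.+ 1)` below denote `1ℂ` itself.
  fromℤ : ℤ → Carrier
  fromℤ (+ n)    = n × 1#
  fromℤ -[1+ n ] = - (suc n × 1#)

  -- Sums of mixed sign are computed by `_⊖_`, so additivity rests on this case. For two successors
  -- the proof inserts 1 - 1 between the multiples and regroups.
  fromℤ-⊖ : ∀ m n → fromℤ (m ⊖ n) ≈ m × 1# - n × 1#
  fromℤ-⊖ m zero = sym (trans (+-congˡ -0#≈0#) (+-identityʳ _))
  fromℤ-⊖ zero (suc n) = sym (+-identityˡ _)
  fromℤ-⊖ (suc m) (suc n) = begin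
    fromℤ (suc m ⊖ suc n)               ≡⟨ ≡.cong fromℤ (ℤ.[1+m]⊖[1+n]≡m⊖n m n) ⟩
    fromℤ (m ⊖ n)                       ≈⟨ fromℤ-⊖ m n ⟩
    m × 1# - n × 1#                     ≈⟨ +-congˡ (+-identityˡ _) ⟨
    m × 1# + (0# - n × 1#)              ≈⟨ +-congˡ (+-congʳ (-‿inverseʳ 1#)) ⟨
    m × 1# + (1# - 1# - n × 1#)         ≈⟨ +-congˡ (+-assoc _ _ _) ⟩
    m × 1# + (1# + (- 1# - n × 1#))     ≈⟨ +-assoc _ _ _ ⟨
    m × 1# + 1# + (- 1# - n × 1#)       ≈⟨ +-cong (trans (+-comm _ _) (sym (×-homo-+ 1# 1 m))) (-‿+-comm _ _) ⟩
    suc m × 1# - (1# + n × 1#)          ≈⟨ +-congˡ (-‿cong (×-homo-+ 1# 1 n)) ⟨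
    suc m × 1# - suc n × 1#             ∎

  fromℤ-+ : ∀ i j → fromℤ (i ℤ.+ j) ≈ fromℤ i + fromℤ j
  fromℤ-+ (+ m)    (+ n)    = ×-homo-+ 1# m n
  fromℤ-+ (+ m)    -[1+ n ] = fromℤ-⊖ m (suc n)
  fromℤ-+ -[1+ m ] (+ n)    = trans (fromℤ-⊖ n (suc m)) (+-comm _ _)
  fromℤ-+ -[1+ m ] -[1+ n ] = begin
    - (suc (suc (m ℕ.+ n)) × 1#)     ≡⟨ ≡.cong (λ k → - (k × 1#)) (ℕ.+-suc (suc m) n) ⟨
    - ((suc m ℕ.+ suc n) × 1#)       ≈⟨ -‿cong (×-homo-+ 1# (suc m) (suc n)) ⟩
    - (suc m × 1# + suc n × 1#)      ≈⟨ -‿+-comm _ _ ⟨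
    - (suc m × 1#) - suc n × 1#      ∎

  fromℤ-neg◃ : ∀ n → fromℤ (Sign.- ◃ n) ≈ - (n × 1#)
  fromℤ-neg◃ zero    = sym -0#≈0#
  fromℤ-neg◃ (suc n) = refl

  fromℤ-pos◃ : ∀ n → fromℤ (Sign.+ ◃ n) ≈ n × 1#
  fromℤ-pos◃ zero    = refl
  fromℤ-pos◃ (suc n) = refl

  fromℤ-* : ∀ i j → fromℤ (i ℤ.* j) ≈ fromℤ i * fromℤ j
  fromℤ-* (+ m)    (+ n)    = trans (fromℤ-pos◃ (m ℕ.* n)) (×1-homo-* m n)
  fromℤ-* (+ m)    -[1+ n ] = trans (fromℤ-neg◃ (m ℕ.* suc n))
    (trans (-‿cong (×1-homo-* m (suc n))) (-‿distribʳ-* _ _))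
  fromℤ-* -[1+ m ] (+ n)    = trans (fromℤ-neg◃ (suc m ℕ.* n))
    (trans (-‿cong (×1-homo-* (suc m) n)) (-‿distribˡ-* _ _))
  fromℤ-* -[1+ m ] -[1+ n ] = begin
    fromℤ (-[1+ m ] ℤ.* -[1+ n ])       ≈⟨ ×1-homo-* (suc m) (suc n) ⟩
    suc m × 1# * (suc n × 1#)           ≈⟨ -‿involutive _ ⟨
    - (- (suc m × 1# * (suc n × 1#)))   ≈⟨ -‿cong (-‿distribʳ-* _ _) ⟩
    - (suc m × 1# * - (suc n × 1#))     ≈⟨ -‿distribˡ-* _ _ ⟩
    - (suc m × 1#) * - (suc n × 1#)     ∎

  fromℤ-neg : ∀ i → fromℤ (ℤ.- i) ≈ - fromℤ i
  fromℤ-neg (+ zero)  = sym -0#≈0#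
  fromℤ-neg (+ suc n) = refl
  fromℤ-neg -[1+ n ]  = sym (-‿involutive _)

  homomorphism : ℤ.+-*-rawRing -Raw-AlmostCommutative⟶ fromCommutativeRing R
  homomorphism = record
    { ⟦_⟧    = fromℤ
    ; +-homo = fromℤ-+
    ; *-homo = fromℤ-*
    ; -‿homo = fromℤ-neg
    ; 0-homo = refl
    ; 1-homo = refl
    }

  _coeff≟_ : ∀ i j → Maybe (fromℤ i ≈ fromℤ j)
  i coeff≟ j = Maybe.map (λ i≡j → reflexive (≡.cong fromℤ i≡j)) (dec⇒maybe (i ℤ.≟ j))

  open import Algebra.Solver.Ring ℤ.+-*-rawRing (fromCommutativeRing R) homomorphism _coeff≟_ public

open import Defs
open import Data.Nat.Base as ℕ using (ℕ; zero; suc)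
import Data.Nat.Properties as ℕ
import Data.Integer.Base as ℤ
open import Data.Fin.Base using (toℕ)
open import Data.Fin.Properties using (toℕ≤pred[n]; toℕ<n; toℕ-inject₁; toℕ-fromℕ)
open import Relation.Binary.PropositionalEquality as ≡ using (_≡_)
open CommutativeRing ℂ-commutativeRing hiding (_≈_; _+_; _*_; -_; _-_)
open import Algebra.Properties.Semiring.Exp semiring using (^-homo-*; ^-congʳ)
open import Algebra.Properties.Semiring.Sum semiring
  using (sum-cong-≋; sum-init-last; *-distribˡ-sum)
open import Relation.Binary.Reasoning.Setoid setoid
open IntegerCoefficients ℂ-commutativeRing using (solve; con; _:+_; _:*_; _:-_; _:=_)

-- Inverses and quotients.

inverse-unique : ∀ {a i j} → a * i ≈ 1ℂ → a * j ≈ 1ℂ → i ≈ j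
inverse-unique {a} {i} {j} ai≈1 aj≈1 = begin
  i            ≈⟨ *-identityʳ i ⟨
  i * 1ℂ       ≈⟨ *-congˡ aj≈1 ⟨
  i * (a * j)  ≈⟨ solve 3 (λ a i j → i :* (a :* j) := a :* i :* j) refl a i j ⟩
  a * i * j    ≈⟨ *-congʳ ai≈1 ⟩
  1ℂ * j       ≈⟨ *-identityˡ j ⟩
  j            ∎

inverse-* : ∀ {a b i j} → a * i ≈ 1ℂ → b * j ≈ 1ℂ → (a * b) * (i * j) ≈ 1ℂ
inverse-* {a} {b} {i} {j} ai≈1 bj≈1 = begin
  (a * b) * (i * j)  ≈⟨ solve 4 (λ a b i j → (a :* b) :* (i :* j) := (a :* i) :* (b :* j)) refl a b i j ⟩
  (a * i) * (b * j)  ≈⟨ *-cong ai≈1 bj≈1 ⟩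
  1ℂ * 1ℂ            ≈⟨ *-identityˡ 1ℂ ⟩
  1ℂ                 ∎

-- Both `i` and `b * j` invert `a`. This turns the recursion of `poch` into one for the inverses of
-- its values.
inverse-cancel : ∀ {a b i j} → a * i ≈ 1ℂ → (a * b) * j ≈ 1ℂ → i ≈ b * j
inverse-cancel {a} {b} {i} {j} ai≈1 abj≈1 =
  inverse-unique ai≈1 (trans (sym (*-assoc a b j)) abj≈1)

-- Any inverse of the denominator may replace the one built from the proof of apartness.
/-cong : ∀ {a b w i w#0} → a ≈ b → w * i ≈ 1ℂ → a / w [ w#0 ] ≈ b * i
/-cong {w = w} {w#0 = w#0} a≈b wi≈1 = *-cong a≈b (inverse-unique (*-⁻¹ w w#0) wi≈1)

-- Finite sums and q-shifted factorials.

sum< : ℕ → (ℕ → ℂ) → ℂ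
-- Unlike in `sum₀` and `sum₁`, the summand receives no bound, so the upper limit can vary while the
-- summand stays fixed.
sum< n f = sum {n} λ i → f (toℕ i)

sum<-suc : ∀ n f → sum< (suc n) f ≈ sum< n f + f n
sum<-suc n f = trans (sum-init-last {n} λ i → f (toℕ i)) (+-cong
  (sum-cong-≋ {n} λ i → reflexive (≡.cong f (toℕ-inject₁ i)))
  (reflexive (≡.cong f (toℕ-fromℕ n))))

1-congˡ : ∀ {a b c} → a ≈ b → 1ℂ - a * c ≈ 1ℂ - b * c
1-congˡ a≈b = +-congˡ (-‿cong (*-congʳ a≈b))

poch-cong : ∀ {a b} q n → a ≈ b → poch a q n ≈ poch b q n
poch-cong q zero    a≈b = refl
poch-cong q (suc n) a≈b = *-cong (poch-cong q n a≈b) (1-congˡ a≈b)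

-- By definition `poch` grows at its last factor; splitting off the first one is what relates yq/x
-- to yq^2/x.
poch-shift : ∀ a q n → poch a q (suc n) ≈ (1ℂ - a) * poch (a * q) q n
poch-shift a q zero    = solve 1 (λ a → con (ℤ.+ 1) :* (con (ℤ.+ 1) :- a :* con (ℤ.+ 1)) :=
  (con (ℤ.+ 1) :- a) :* con (ℤ.+ 1)) refl a
poch-shift a q (suc n) = begin
  poch a q (suc n) * (1ℂ - a * (q * q ^ n))
    ≈⟨ *-congʳ (poch-shift a q n) ⟩
  (1ℂ - a) * poch (a * q) q n * (1ℂ - a * (q * q ^ n))
    ≈⟨ solve 4 (λ a q P M → (con (ℤ.+ 1) :- a) :* P :* (con (ℤ.+ 1) :- a :* (q :* M)) :=
         (con (ℤ.+ 1) :- a) :* (P :* (con (ℤ.+ 1) :- a :* q :* M))) refl a q (poch (a * q) q n) (q ^ n) ⟩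
  (1ℂ - a) * poch (a * q) q (suc n) ∎

-- What remains of `step` without its common factor: `M` and `K` stand for q^m and q^k, and `v` for
-- q/x. With all five variables independent it holds by expansion.
wz-identity : ∀ q y v M K →
  (1ℂ - (q * y * v) * M) * (1ℂ - q * (M * K)) * K + q * M * (1ℂ - K) * (v - K) ≈
  (1ℂ - (q * v) * M) * (1ℂ - q * M) * K + q * M * v * (1ℂ - q * (M * K)) * (1ℂ - y * K)
wz-identity = solve 5 (λ q y v M K → let l = con (ℤ.+ 1) in
  (l :- (q :* y :* v) :* M) :* (l :- q :* (M :* K)) :* K :+ q :* M :* (l :- K) :* (v :- K) :=
  (l :- (q :* v) :* M) :* (l :- q :* M) :* K :+ q :* M :* v :* (l :- q :* (M :* K)) :* (l :- y :* K)) refl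

-- The telescoping relation between sums for consecutive m.

module Telescoping
  (q : ℂ) (∣q∣<1 : ∣ q ∣ <ᵣ 1ᵣ) (N : ℕ) (x y : ℂ)
  (x≠0 : x # 0ℂ) (x≠yq : x # y * q)
  (x⨾q≠0 : poch x q N # 0ℂ)
  (q²/x⨾q≠0 : poch (q ^ 2 / x [ x≠0 ]) q N # 0ℂ)
  where

  x⁻¹ d u v w z : ℂ
  x⁻¹ = x ⁻¹[ x≠0 ]
  d   = (x - y * q) ⁻¹[ #⇒-#0 x≠yq ]
  u   = (y * q) / x [ x≠0 ]
  v   = q / x [ x≠0 ]
  w   = (y * q ^ 2) / x [ x≠0 ]
  z   = q ^ 2 / x [ x≠0 ]

  -- Capping the index at N makes the inverses total functions of the index.
  poch⁻¹ : ∀ {a} → poch a q N # 0ℂ → ℕ → ℂ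
  poch⁻¹ {a} a#0 k = poch a q (k ℕ.⊓ N) ⁻¹[ poch-≤ (ℕ.m⊓n≤n k N) a#0 ]

  -- `Q⁻¹` is total without a cap, since |q| < 1 makes every (q;q)_n invertible.
  X⁻¹ Z⁻¹ Q⁻¹ : ℕ → ℂ
  X⁻¹ = poch⁻¹ x⨾q≠0
  Z⁻¹ = poch⁻¹ q²/x⨾q≠0
  Q⁻¹ n = poch q q n ⁻¹[ poch-q-q ∣q∣<1 n ]

  poch⁻¹-inverse : ∀ {a} (a#0 : poch a q N # 0ℂ) {k} → k ℕ.≤ N → poch a q k * poch⁻¹ a#0 k ≈ 1ℂ
  poch⁻¹-inverse {a} a#0 {k} k≤N =
    ≡.subst (λ j → poch a q j * poch⁻¹ a#0 k ≈ 1ℂ) (ℕ.m≤n⇒m⊓n≡m k≤N) (*-⁻¹ _ _)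

  poch⁻¹-suc : ∀ {a} (a#0 : poch a q N # 0ℂ) {k} → suc k ℕ.≤ N →
               poch⁻¹ a#0 k ≈ (1ℂ - a * q ^ k) * poch⁻¹ a#0 (suc k)
  poch⁻¹-suc a#0 {k} k<N =
    inverse-cancel (poch⁻¹-inverse a#0 (ℕ.<⇒≤ k<N)) (poch⁻¹-inverse a#0 k<N)

  Q⁻¹-inverse : ∀ n → poch q q n * Q⁻¹ n ≈ 1ℂ
  Q⁻¹-inverse n = *-⁻¹ _ _

  Q⁻¹-suc : ∀ n → Q⁻¹ n ≈ (1ℂ - q * q ^ n) * Q⁻¹ (suc n)
  Q⁻¹-suc n = inverse-cancel (Q⁻¹-inverse n) (Q⁻¹-inverse (suc n))

  x*x⁻¹ : x * x⁻¹ ≈ 1ℂ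
  x*x⁻¹ = *-⁻¹ x x≠0

  w≈ : w ≈ q * y * v
  w≈ = solve 3 (λ q y x⁻¹ → y :* (q :* (q :* con (ℤ.+ 1))) :* x⁻¹ := q :* y :* (q :* x⁻¹)) refl q y x⁻¹

  z≈ : z ≈ q * v
  z≈ = solve 2 (λ q x⁻¹ → q :* (q :* con (ℤ.+ 1)) :* x⁻¹ := q :* (q :* x⁻¹)) refl q x⁻¹

  -- G comes from Gosper's algorithm applied to F (suc m) k - F m k in k.
  F G : ℕ → ℕ → ℂ
  F m k = poch w q m * Z⁻¹ m *
    (poch q q (m ℕ.+ k) * (Q⁻¹ m * Q⁻¹ k) * (poch y q k * X⁻¹ k) * q ^ k)
  G m k = poch w q m * Z⁻¹ (suc m) * (poch q q (m ℕ.+ k) * (Q⁻¹ (suc m) * Q⁻¹ k)) *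
    (poch y q k * X⁻¹ k) * (q * q ^ m * (1ℂ - q ^ k) * (v - q ^ k))

  -- The factor `1ℂ - q ^ k` of `G` vanishes at k = 0, so only the upper end of a telescoped sum
  -- survives.
  G-zero : ∀ m → G m 0 ≈ 0ℂ
  G-zero m = solve 3 (λ a b c → a :* (b :* (con (ℤ.+ 1) :- con (ℤ.+ 1)) :* c) := con (ℤ.+ 0)) refl
    _ (q * q ^ m) (v - 1ℂ)

  -- All four terms are multiples of `D`, which carries the inverses at `suc m` and at `k`; the
  -- cofactors satisfy `wz-identity`.
  step : ∀ m k → suc m ℕ.≤ N → suc k ℕ.≤ N → F (suc m) k + G m k ≈ F m k + G m (suc k)
  step m k m<N k<N = begin
    F (suc m) k + G m k
      ≈⟨ +-congʳ F′-factor ⟩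
    D * (s * t * K) + G m k
      ≈⟨ distribˡ D _ _ ⟨
    D * (s * t * K + q * M * (1ℂ - K) * (v - K))
      ≈⟨ *-congˡ (+-congʳ (*-congʳ (*-cong (1-congˡ w≈) t≈))) ⟩
    D * ((1ℂ - (q * y * v) * M) * (1ℂ - q * (M * K)) * K + q * M * (1ℂ - K) * (v - K))
      ≈⟨ *-congˡ (wz-identity q y v M K) ⟩
    D * ((1ℂ - (q * v) * M) * (1ℂ - q * M) * K + q * M * v * (1ℂ - q * (M * K)) * (1ℂ - y * K))
      ≈⟨ *-congˡ (+-cong (*-congʳ (*-congʳ (1-congˡ z≈))) (*-congʳ (*-congˡ t≈))) ⟨
    D * (r * (1ℂ - q * M) * K + q * M * v * t * (1ℂ - y * K))
      ≈⟨ distribˡ D _ _ ⟩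
    D * (r * (1ℂ - q * M) * K) + D * (q * M * v * t * (1ℂ - y * K))
      ≈⟨ +-cong F-factor G′-factor ⟨
    F m k + G m (suc k) ∎
    where
    M K a z′ p Q′ Y D s t r : ℂ
    M  = q ^ m
    K  = q ^ k
    a  = poch w q m
    z′ = Z⁻¹ (suc m)
    p  = poch q q (m ℕ.+ k)
    Q′ = Q⁻¹ (suc m)
    Y  = poch y q k
    D  = a * z′ * (p * (Q′ * Q⁻¹ k)) * (Y * X⁻¹ k)
    s  = 1ℂ - w * M
    t  = 1ℂ - q * q ^ (m ℕ.+ k)
    r  = 1ℂ - z * M

    t≈ : t ≈ 1ℂ - q * (M * K)
    t≈ = +-congˡ (-‿cong (*-congˡ (^-homo-* q m k)))

    -- Because x v = q, the last factor of `G m (suc k)` contains the last factor of (x;q)_(k+1).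
    v≈ : v - q * K ≈ v * (1ℂ - x * K)
    v≈ = begin
      v - q * K                    ≈⟨ +-congˡ (-‿cong (*-congʳ (trans (*-congˡ x*x⁻¹) (*-identityʳ q)))) ⟨
      v - q * (x * x⁻¹) * K        ≈⟨ solve 4 (λ q x x⁻¹ K → q :* x⁻¹ :- q :* (x :* x⁻¹) :* K :=
                                        q :* x⁻¹ :* (con (ℤ.+ 1) :- x :* K)) refl q x x⁻¹ K ⟩
      v * (1ℂ - x * K)             ∎

    F′-factor : F (suc m) k ≈ D * (s * t * K)
    F′-factor = solve 10 (λ a s z′ p t Q′ Qk Y X K →
      (a :* s) :* z′ :* ((p :* t) :* (Q′ :* Qk) :* (Y :* X) :* K) :=
      a :* z′ :* (p :* (Q′ :* Qk)) :* (Y :* X) :* (s :* t :* K)) refl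
      a s z′ p t Q′ (Q⁻¹ k) Y (X⁻¹ k) K

    -- Raising the inverses `Z⁻¹ m` and `Q⁻¹ m` to index `suc m` costs the factors `r` and
    -- `1ℂ - q * M`.
    F-factor : F m k ≈ D * (r * (1ℂ - q * M) * K)
    F-factor = trans
      (*-cong (*-congˡ (poch⁻¹-suc q²/x⨾q≠0 m<N)) (*-congʳ (*-congʳ (*-congˡ (*-congʳ (Q⁻¹-suc m))))))
      (solve 10 (λ a r z′ p f Q′ Qk Y X K →
        a :* (r :* z′) :* (p :* ((f :* Q′) :* Qk) :* (Y :* X) :* K) :=
        a :* z′ :* (p :* (Q′ :* Qk)) :* (Y :* X) :* (r :* f :* K)) refl
        a r z′ p (1ℂ - q * M) Q′ (Q⁻¹ k) Y (X⁻¹ k) K)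

    -- The factors `1ℂ - q * K` and, through `v≈`, `1ℂ - x * K` lower the inverses from `suc k` to
    -- `k`.
    G′-factor : G m (suc k) ≈ D * (q * M * v * t * (1ℂ - y * K))
    G′-factor = begin
      G m (suc k)
        ≈⟨ *-cong (*-congʳ (*-congˡ (*-congʳ (reflexive (≡.cong (poch q q) (ℕ.+-suc m k)))))) (*-congˡ v≈) ⟩
      a * z′ * (p * t * (Q′ * Q⁻¹ (suc k))) * (Y * (1ℂ - y * K) * X⁻¹ (suc k)) *
        (q * M * (1ℂ - q * K) * (v * (1ℂ - x * K)))
        ≈⟨ solve 13 (λ a z′ p t Q′ Qk Y e X q*M f v g →
             a :* z′ :* (p :* t :* (Q′ :* Qk)) :* (Y :* e :* X) :* (q*M :* f :* (v :* g)) :=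
             a :* z′ :* (p :* (Q′ :* (f :* Qk))) :* (Y :* (g :* X)) :* (q*M :* v :* t :* e)) refl
             a z′ p t Q′ (Q⁻¹ (suc k)) Y (1ℂ - y * K) (X⁻¹ (suc k)) (q * M) (1ℂ - q * K) v (1ℂ - x * K) ⟩
      a * z′ * (p * (Q′ * ((1ℂ - q * K) * Q⁻¹ (suc k)))) * (Y * ((1ℂ - x * K) * X⁻¹ (suc k))) *
        (q * M * v * t * (1ℂ - y * K))
        ≈⟨ *-congʳ (*-cong (*-congˡ (*-congˡ (*-congˡ (Q⁻¹-suc k)))) (*-congˡ (poch⁻¹-suc x⨾q≠0 k<N))) ⟨
      D * (q * M * v * t * (1ℂ - y * K)) ∎

  -- Adds up `step` over k < j. At `j = suc m` the sum of `F m` is complete, while that of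
  -- `F (suc m)` still lacks its last term.
  telescope : ∀ m j → suc m ℕ.≤ N → j ℕ.≤ suc m → sum< j (F (suc m)) ≈ sum< j (F m) + G m j
  telescope m zero    m<N j≤m = sym (trans (+-identityˡ _) (G-zero m))
  telescope m (suc j) m<N j<m = begin
    sum< (suc j) (F (suc m))              ≈⟨ sum<-suc j (F (suc m)) ⟩
    sum< j (F (suc m)) + F (suc m) j      ≈⟨ +-congʳ (telescope m j m<N (ℕ.<⇒≤ j<m)) ⟩
    sum< j (F m) + G m j + F (suc m) j    ≈⟨ +-assoc _ _ _ ⟩
    sum< j (F m) + (G m j + F (suc m) j)  ≈⟨ +-congˡ (+-comm _ _) ⟩
    sum< j (F m) + (F (suc m) j + G m j)  ≈⟨ +-congˡ (step m j m<N (ℕ.≤-trans j<m m<N)) ⟩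
    sum< j (F m) + (F m j + G m (suc j))  ≈⟨ +-assoc _ _ _ ⟨
    sum< j (F m) + F m j + G m (suc j)    ≈⟨ +-congʳ (sum<-suc j (F m)) ⟨
    sum< (suc j) (F m) + G m (suc j)      ∎

  -- The right-hand terms as boundary contributions.

  ratio S T : ℕ → ℂ
  ratio k = (poch y q k * poch u q k) * (X⁻¹ k * Z⁻¹ k)
  -- Index `j` holds the term k = j + 1, with 2k - 1 split as j + (j + 1).
  S j = poch q q (j ℕ.+ suc j) * (Q⁻¹ j * Q⁻¹ (suc j)) * ratio (suc j) * q ^ suc j
  T j = poch q q (suc j ℕ.+ suc j) * (Q⁻¹ (suc j) * Q⁻¹ (suc j)) * ratio (suc j) * q ^ (suc j ℕ.+ suc j)

  α β : ℂ
  α = (q + x) / (x - y * q) [ #⇒-#0 x≠yq ]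
  β = (y * q) / (x - y * q) [ #⇒-#0 x≠yq ]

  -- Since x - yq = x (1 - yq/x), the denominator of `α` and `β` absorbs the first factor of
  -- (yq/x;q)_(m+1), which `poch-u` splits off.
  d*[1-u] : d * (1ℂ - u) ≈ x⁻¹
  d*[1-u] = begin
    d * (1ℂ - u)                ≈⟨ *-congˡ (+-congʳ x*x⁻¹) ⟨
    d * (x * x⁻¹ - u)           ≈⟨ solve 5 (λ d q x y x⁻¹ → d :* (x :* x⁻¹ :- y :* q :* x⁻¹) :=
                                     (x :- y :* q) :* d :* x⁻¹) refl d q x y x⁻¹ ⟩
    (x - y * q) * d * x⁻¹       ≈⟨ *-congʳ (*-⁻¹ (x - y * q) (#⇒-#0 x≠yq)) ⟩
    1ℂ * x⁻¹                    ≈⟨ *-identityˡ x⁻¹ ⟩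
    x⁻¹                         ∎

  poch-u : ∀ m → poch u q (suc m) ≈ (1ℂ - u) * poch w q m
  poch-u m = trans (poch-shift u q m) (*-congˡ (poch-cong q m
    (solve 3 (λ q y x⁻¹ → y :* q :* x⁻¹ :* q := y :* (q :* (q :* con (ℤ.+ 1))) :* x⁻¹) refl q y x⁻¹)))

  -- Up to the common factor `C` the two terms are (1 - yvK)(1 + K) and v - K, where K = q^(m+1).
  -- The lone K cancels, leaving v + 1 = (q + x)/x for `α` and -(yq/x)(1 + K)K for `β`.
  boundary : ∀ m → suc m ℕ.≤ N → F (suc m) (suc m) + G m (suc m) ≈ α * S m - β * T m
  boundary m m<N = begin
    F n n + G m n
      ≈⟨ +-cong F-factor G-factor ⟩
    C * ((1ℂ - (q * y * v) * M) * (1ℂ + K)) + C * (v - K)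
      ≈⟨ solve 5 (λ C q y x⁻¹ M → let K = q :* M; l = con (ℤ.+ 1) in
           C :* ((l :- (q :* y :* (q :* x⁻¹)) :* M) :* (l :+ K)) :+ C :* (q :* x⁻¹ :- K) :=
           C :* (q :* x⁻¹ :+ l) :- C :* (y :* q :* ((l :+ K) :* K) :* x⁻¹)) refl C q y x⁻¹ M ⟩
    C * (v + 1ℂ) - C * (y * q * ((1ℂ + K) * K) * x⁻¹)
      ≈⟨ +-congʳ (*-congˡ (trans (distribʳ x⁻¹ q x) (+-congˡ x*x⁻¹))) ⟨
    C * ((q + x) * x⁻¹) - C * (y * q * ((1ℂ + K) * K) * x⁻¹)
      ≈⟨ +-cong (*-congˡ (*-congˡ d*[1-u])) (-‿cong (*-congˡ (*-congˡ d*[1-u]))) ⟨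
    C * ((q + x) * (d * (1ℂ - u))) - C * (y * q * ((1ℂ + K) * K) * (d * (1ℂ - u)))
      ≈⟨ +-cong αS-factor (-‿cong βT-factor) ⟨
    α * S m - β * T m ∎
    where
    n : ℕ
    n = suc m
    M K a z′ p Q′ Y X C : ℂ
    M  = q ^ m
    K  = q ^ n
    a  = poch w q m
    z′ = Z⁻¹ n
    p  = poch q q (m ℕ.+ n)
    Q′ = Q⁻¹ n
    Y  = poch y q n
    X  = X⁻¹ n
    C  = a * z′ * (p * (Q′ * Q′)) * (Y * X) * ((1ℂ - K) * K)

    -- The last factor 1 - q^(2n) is a difference of squares. This links the q-binomials with upper
    -- entries 2n and 2n - 1.
    p-suc : poch q q (n ℕ.+ n) ≈ p * ((1ℂ - K) * (1ℂ + K))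
    p-suc = *-congˡ (trans (+-congˡ (-‿cong (*-congˡ (^-homo-* q m n))))
      (solve 2 (λ q M → con (ℤ.+ 1) :- q :* (M :* (q :* M)) :=
        (con (ℤ.+ 1) :- q :* M) :* (con (ℤ.+ 1) :+ q :* M)) refl q M))

    F-factor : F n n ≈ C * ((1ℂ - (q * y * v) * M) * (1ℂ + K))
    F-factor = trans
      (*-cong (*-congʳ (*-congˡ (1-congˡ w≈))) (*-congʳ (*-congʳ (*-congʳ p-suc))))
      (solve 10 (λ a s z′ p f g Q′ Y X K →
        (a :* s) :* z′ :* ((p :* (f :* g)) :* (Q′ :* Q′) :* (Y :* X) :* K) :=
        a :* z′ :* (p :* (Q′ :* Q′)) :* (Y :* X) :* (f :* K) :* (s :* g)) refl
        a (1ℂ - (q * y * v) * M) z′ p (1ℂ - K) (1ℂ + K) Q′ Y X K)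

    G-factor : G m n ≈ C * (v - K)
    G-factor = solve 4 (λ A K f e → A :* (K :* f :* e) := A :* (f :* K) :* e) refl
      (a * z′ * (p * (Q′ * Q′)) * (Y * X)) K (1ℂ - K) (v - K)

    αS-factor : α * S m ≈ C * ((q + x) * (d * (1ℂ - u)))
    αS-factor = trans
      (*-congˡ (*-congʳ (*-cong (*-congˡ (*-congʳ (Q⁻¹-suc m))) (*-congʳ (*-congˡ (poch-u m))))))
      (solve 11 (λ a z′ p f Q′ Y X K g d h →
        (g :* d) :* (p :* ((f :* Q′) :* Q′) :* ((Y :* (h :* a)) :* (X :* z′)) :* K) :=
        a :* z′ :* (p :* (Q′ :* Q′)) :* (Y :* X) :* (f :* K) :* (g :* (d :* h))) refl
        a z′ p (1ℂ - K) Q′ Y X K (q + x) d (1ℂ - u))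

    βT-factor : β * T m ≈ C * (y * q * ((1ℂ + K) * K) * (d * (1ℂ - u)))
    βT-factor = trans
      (*-congˡ (*-cong (*-cong (*-congʳ p-suc) (*-congʳ (*-congˡ (poch-u m)))) (^-homo-* q n n)))
      (solve 12 (λ a z′ p f e Q′ Y X K g d h →
        (g :* d) :* (p :* (f :* e) :* (Q′ :* Q′) :* ((Y :* (h :* a)) :* (X :* z′)) :* (K :* K)) :=
        a :* z′ :* (p :* (Q′ :* Q′)) :* (Y :* X) :* (f :* K) :* (g :* (e :* K) :* (d :* h))) refl
        a z′ p (1ℂ - K) (1ℂ + K) Q′ Y X K (y * q) d (1ℂ - u))

  -- Induction on `m` with `N` fixed, so that the invertibility assumed at `N` serves every stage;
  -- `telescope` and `boundary` supply the increment.
  partial-sum : ∀ m → m ℕ.≤ N → sum< (suc m) (F m) ≈ 1ℂ + α * sum< m S - β * sum< m T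
  partial-sum zero _ = begin
    F 0 0 + 0ℂ
      -- All factorials here are empty products, and the inverse of 1 is 1; uniqueness of inverses
      -- evaluates `Q⁻¹ 0 * Q⁻¹ 0`.
      ≈⟨ +-congʳ (*-cong (poch⁻¹-inverse q²/x⨾q≠0 ℕ.z≤n) (*-congʳ (*-cong
           (*-cong refl (inverse-unique (trans (*-congʳ (sym (*-identityˡ 1ℂ))) (inverse-* (Q⁻¹-inverse 0) (Q⁻¹-inverse 0))) (*-identityˡ 1ℂ)))
           (poch⁻¹-inverse x⨾q≠0 ℕ.z≤n)))) ⟩
    1ℂ * (1ℂ * 1ℂ * 1ℂ * 1ℂ) + 0ℂ
      ≈⟨ solve 2 (λ α β → let l = con (ℤ.+ 1); o = con (ℤ.+ 0) in
           l :* (l :* l :* l :* l) :+ o := l :+ α :* o :- β :* o) refl α β ⟩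
    1ℂ + α * 0ℂ - β * 0ℂ ∎
  partial-sum (suc m) m<N = begin
    sum< (suc (suc m)) (F (suc m))
      ≈⟨ sum<-suc (suc m) (F (suc m)) ⟩
    sum< (suc m) (F (suc m)) + F (suc m) (suc m)
      ≈⟨ +-congʳ (telescope m (suc m) m<N ℕ.≤-refl) ⟩
    sum< (suc m) (F m) + G m (suc m) + F (suc m) (suc m)
      ≈⟨ trans (+-assoc _ _ _) (+-congˡ (+-comm _ _)) ⟩
    sum< (suc m) (F m) + (F (suc m) (suc m) + G m (suc m))
      ≈⟨ +-cong (partial-sum m (ℕ.<⇒≤ m<N)) (boundary m m<N) ⟩
    1ℂ + α * sum< m S - β * sum< m T + (α * S m - β * T m)
      ≈⟨ solve 6 (λ α β ΣS ΣT s t → let l = con (ℤ.+ 1) in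
           l :+ α :* ΣS :- β :* ΣT :+ (α :* s :- β :* t) :=
           l :+ α :* (ΣS :+ s) :- β :* (ΣT :+ t)) refl α β (sum< m S) (sum< m T) (S m) (T m) ⟩
    1ℂ + α * (sum< m S + S m) - β * (sum< m T + T m)
      ≈⟨ +-cong (+-congˡ (*-congˡ (sum<-suc m S))) (-‿cong (*-congˡ (sum<-suc m T))) ⟨
    1ℂ + α * sum< (suc m) S - β * sum< (suc m) T ∎

  -- Writing the upper entry as a sum resolves the truncated subtraction in `qbinom`; the equation
  -- admits the entries 2k and 2k - 1 as they are stated.
  qbinom-+ : ∀ {n} k l → n ≡ k ℕ.+ l → qbinom q ∣q∣<1 n l ≈ poch q q (k ℕ.+ l) * (Q⁻¹ k * Q⁻¹ l)
  qbinom-+ k l ≡.refl = /-cong refl (inverse-*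
    (trans (*-congʳ (reflexive (≡.cong (poch q q) (ℕ.m+n∸n≡m k l)))) (Q⁻¹-inverse k)) (Q⁻¹-inverse l))

theorem3p6 : (q : ℂ) (∣q∣<1 : ∣ q ∣ <ᵣ 1ᵣ) (m : ℕ) (x y : ℂ)
    (x≠0 : x # 0ℂ) (x≠yq : x # y * q)
    (x⨾q≠0 : poch x q m # 0ℂ)
    (q²/x⨾q≠0 : poch (q ^ 2 / x [ x≠0 ]) q m # 0ℂ) →
    (poch ((y * q ^ 2) / x [ x≠0 ]) q m / poch (q ^ 2 / x [ x≠0 ]) q m [ q²/x⨾q≠0 ])
    * sum₀ m (λ k k≤m →
    qbinom q ∣q∣<1 (m ℕ.+ k) k
    * (poch y q k / poch x q k [ poch-≤ k≤m x⨾q≠0 ])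
    * q ^ k)
    ≈
    1ℂ
    + ((q + x) / (x - y * q) [ #⇒-#0 x≠yq ])
    * sum₁ m (λ k k≤m →
    qbinom q ∣q∣<1 (2 ℕ.* k ℕ.∸ 1) k
    * ((poch y q k * poch ((y * q) / x [ x≠0 ]) q k)
    / (poch x q k * poch (q ^ 2 / x [ x≠0 ]) q k)
    [ #0-* (poch-≤ k≤m x⨾q≠0) (poch-≤ k≤m q²/x⨾q≠0) ])
    * q ^ k)
    - ((y * q) / (x - y * q) [ #⇒-#0 x≠yq ])
    * sum₁ m (λ k k≤m →
    qbinom q ∣q∣<1 (2 ℕ.* k) k
    * ((poch y q k * poch ((y * q) / x [ x≠0 ]) q k)
    / (poch x q k * poch (q ^ 2 / x [ x≠0 ]) q k)
    [ #0-* (poch-≤ k≤m x⨾q≠0) (poch-≤ k≤m q²/x⨾q≠0) ])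
    * q ^ (2 ℕ.* k))
theorem3p6 q ∣q∣<1 m x y x≠0 x≠yq x⨾q≠0 q²/x⨾q≠0 = begin
  _ ≈⟨ *-congˡ (sum-cong-≋ {suc m} λ i → summand≈ (toℕ≤pred[n] i)) ⟩
  poch w q m / poch z q m [ q²/x⨾q≠0 ] * sum< (suc m) f
    ≈⟨ *-congʳ (/-cong refl (poch⁻¹-inverse q²/x⨾q≠0 ℕ.≤-refl)) ⟩
  poch w q m * Z⁻¹ m * sum< (suc m) f
    ≈⟨ *-distribˡ-sum {suc m} _ (λ i → f (toℕ i)) ⟩
  sum< (suc m) (F m)
    ≈⟨ partial-sum m ℕ.≤-refl ⟩
  1ℂ + α * sum< m S - β * sum< m T
    -- Read from right to left. The index `i` is k - 1, and 2k is rewritten both in the q-binomial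
    -- and in the exponent.
    ≈⟨ +-cong
         (+-congˡ (*-congˡ (sum-cong-≋ {m} λ i → *-congʳ (*-cong
           (qbinom-+ (toℕ i) (suc (toℕ i)) (2k-1≡ (toℕ i))) (ratio≈ (toℕ<n i))))))
         (-‿cong (*-congˡ (sum-cong-≋ {m} λ i → *-cong (*-cong
           (qbinom-+ (suc (toℕ i)) (suc (toℕ i)) (2k≡ (suc (toℕ i)))) (ratio≈ (toℕ<n i)))
           (^-congʳ q (2k≡ (suc (toℕ i))))))) ⟨
  _ ∎
  where
  open Telescoping q ∣q∣<1 m x y x≠0 x≠yq x⨾q≠0 q²/x⨾q≠0
  -- `F m` without its prefactor, which in the statement multiplies the whole sum.
  f : ℕ → ℂ
  f k = poch q q (m ℕ.+ k) * (Q⁻¹ m * Q⁻¹ k) * (poch y q k * X⁻¹ k) * q ^ k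
  2k≡ : ∀ k → 2 ℕ.* k ≡ k ℕ.+ k
  2k≡ k = ≡.cong (k ℕ.+_) (ℕ.+-identityʳ k)
  2k-1≡ : ∀ j → 2 ℕ.* suc j ℕ.∸ 1 ≡ j ℕ.+ suc j
  2k-1≡ j = ≡.cong (ℕ._∸ 1) (2k≡ (suc j))
  ratio≈ : ∀ {k} (k≤m : k ℕ.≤ m) →
    (poch y q k * poch u q k) / (poch x q k * poch z q k)
      [ #0-* (poch-≤ k≤m x⨾q≠0) (poch-≤ k≤m q²/x⨾q≠0) ] ≈ ratio k
  ratio≈ k≤m = /-cong refl (inverse-* (poch⁻¹-inverse x⨾q≠0 k≤m) (poch⁻¹-inverse q²/x⨾q≠0 k≤m))
  summand≈ : ∀ {k} (k≤m : k ℕ.≤ m) →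
    qbinom q ∣q∣<1 (m ℕ.+ k) k * (poch y q k / poch x q k [ poch-≤ k≤m x⨾q≠0 ]) * q ^ k ≈ f k
  summand≈ {k} k≤m = *-congʳ (*-cong (qbinom-+ m k ≡.refl) (/-cong refl (poch⁻¹-inverse x⨾q≠0 k≤m)))
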